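{- Let $S\subset[0,1]^n$ be a nonobtuse $0/1$-simplex whose fully indecomposable components are all acute. Then for every $(n-1)$-dimensional facet $F$ of $S$ that is not contained in an $(n-1)$-dimensional facet of $[0,1]^n$, there is at most one nonobtuse $0/1$-simplex $\hat S\neq S$ in $[0,1]^n$ having $F$ as a facet.
   Context: A $0/1$-simplex in $[0,1]^n$ is the convex hull of $n+1$ affinely independent points of $\{0,1\}^n$. A simplex is nonobtuse (resp. acute) if each dihedral angle ($\pi$ minus the angle between the inward normals of two facets) is at most (resp. less than) $\pi/2$; a $1$-simplex is regarded as acute. A matrix representation of $S$ is a matrix in $\{0,1\}^{n\times n}$ whose columns are, in some order, $\Pi(u\oplus w)$ for the vertices $u\neq w$ of $S$, with $w$ a fixed vertex of $S$, $\Pi$ a permutation matrix and $\oplus$ coordinatewise addition mod $2$. A matrix $A\in\{0,1\}^{m\times m}$ is partly decomposable if there exist $j\in\{1,\dots,m-1\}$ and permutation matrices $\Pi_1,\Pi_2$ with $\Pi_1^\top A\Pi_2=\begin{bmatrix}A_{11}&A_{12}\\0&A_{22}\end{bmatrix}$, $A_{11}$ of size $j\times j$; otherwise fully indecomposable. The fully indecomposable components of $S$: take a matrix representation $P$ of $S$ and permutation matrices $\Pi_1,\Pi_2$ such that $\Pi_1P\Pi_2$ is block upper triangular with square fully indecomposable diagonal blocks $A_1,\dots,A_p$ ($A_i\in\{0,1\}^{k_i\times k_i}$, $k_1+\dots+k_p=n$); the components are the simplices $\mathrm{conv}\{0,\text{columns of }A_i\}\subset\mathbb{R}^{k_i}$.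 A face-to-face neighbor of $S$ at a facet $F$ is a $0/1$-simplex in $[0,1]^n$ other than $S$ having $F$ as a facet. -}

module Defs where

open import Data.Nat using (ℕ; zero; suc)
import Data.Nat as ℕ
open import Data.Bool using (Bool; true; false; if_then_else_; _xor_)
open import Data.Fin using (Fin; zero; suc; toℕ; punchIn; _≟_)
import Data.Fin as F
open import Data.Fin.Permutation using (Permutation′; _⟨$⟩ʳ_)
open import Data.Rational using (ℚ; 0ℚ; 1ℚ; _+_; _*_; _-_; _≤_; _<_)
open import Data.Product using (Σ; ∃; _×_; _,_)
open import Function.Bundles using (_↔_; Inverse)
open import Relation.Nullary using (¬_; yes; no)
open import Relation.Binary.PropositionalEquality using (_≡_; _≢_)

Σ[_] : {n : ℕ} → (Fin n → ℚ) → ℚ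
Σ[_] {zero}  f = 0ℚ
Σ[_] {suc n} f = f zero + Σ[ (λ i → f (suc i)) ]

dot : {n : ℕ} → (Fin n → ℚ) → (Fin n → ℚ) → ℚ
dot x y = Σ[ (λ c → x c * y c) ]

_⊖_ : {n : ℕ} → (Fin n → ℚ) → (Fin n → ℚ) → (Fin n → ℚ)
(x ⊖ y) c = x c - y c

toℚ : Bool → ℚ
toℚ b = if b then 1ℚ else 0ℚ

embed : {m n : ℕ} → (Fin m → Fin n → Bool) → (Fin m → Fin n → ℚ)
embed v j c = toℚ (v j c)

AffInd : {m : ℕ} → (Fin (suc m) → Fin m → ℚ) → Set
AffInd {m} x = (μ : Fin (suc m) → ℚ) → Σ[ μ ] ≡ 0ℚ →
  ((c : Fin m) → Σ[ (λ j → μ j * x j c) ] ≡ 0ℚ) → (j : Fin (suc m)) → μ j ≡ 0ℚ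

IsInwardNormal : {m : ℕ} → (Fin (suc m) → Fin m → ℚ) → Fin (suc m) → (Fin m → ℚ) → Set
IsInwardNormal x i g =
  ((j k : Fin _) → j ≢ i → k ≢ i → dot g (x j ⊖ x k) ≡ 0ℚ) ×
  ((k : Fin _) → k ≢ i → 0ℚ < dot g (x i ⊖ x k))

-- dihedral angle between facets i and j = π − angle between inward normals;
-- it is ≤ π/2 iff the inner product of the inward normals is ≤ 0 (< for acute)
Nonobtuse : {m : ℕ} → (Fin (suc m) → Fin m → ℚ) → Set
Nonobtuse x = (i j : Fin _) → i ≢ j → (g h : Fin _ → ℚ) →
  IsInwardNormal x i g → IsInwardNormal x j h → dot g h ≤ 0ℚ

Acute : {m : ℕ} → (Fin (suc m) → Fin m → ℚ) → Set
Acute x = (i j : Fin _) → i ≢ j → (g h : Fin _ → ℚ) →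
  IsInwardNormal x i g → IsInwardNormal x j h → dot g h < 0ℚ

Is01Simplex : {n : ℕ} → (Fin (suc n) → Fin n → Bool) → Set
Is01Simplex v = AffInd (embed v)

Mat : ℕ → Set
Mat m = Fin m → Fin m → Bool      -- A r c : row r, column c

-- Π₁ᵀ A Π₂ = [[A11, A12], [0, A22]] with A11 of size j×j, 1 ≤ j ≤ m-1
PartlyDecomposable : {m : ℕ} → Mat m → Set
PartlyDecomposable {m} A = Σ ℕ λ j → (1 ℕ.≤ j) × (j ℕ.< m) ×
  Σ (Permutation′ m) λ π₁ → Σ (Permutation′ m) λ π₂ →
    (r c : Fin m) → j ℕ.≤ toℕ r → toℕ c ℕ.< j → A (π₁ ⟨$⟩ʳ r) (π₂ ⟨$⟩ʳ c) ≡ false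

FullyIndecomposable : {m : ℕ} → Mat m → Set
FullyIndecomposable A = ¬ PartlyDecomposable A

colSimplex : {k : ℕ} → Mat k → Fin (suc k) → Fin k → ℚ
colSimplex B zero    a = 0ℚ
colSimplex B (suc b) a = toℚ (B a b)

-- A block upper triangular form Π₁ P Π₂ of P with square fully indecomposable
-- diagonal blocks A_1,…,A_p (sizes k_1,…,k_p ≥ 1) all of whose components
-- conv{0, columns of A_i} are acute.  Position (i , a) = a-th row (column)
-- inside the i-th block; the bijections rowPos/colPos encode Π₁, Π₂.
record AcuteBlockForm (n : ℕ) (P : Mat n) : Set where
  field
    p      : ℕ
    k      : Fin p → ℕ
    k≥1    : (i : Fin p) → 1 ℕ.≤ k i
    rowPos : Σ (Fin p) (λ i → Fin (k i)) ↔ Fin n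
    colPos : Σ (Fin p) (λ i → Fin (k i)) ↔ Fin n
  row : (i : Fin p) → Fin (k i) → Fin n
  row i a = Inverse.to rowPos (i , a)
  col : (i : Fin p) → Fin (k i) → Fin n
  col i a = Inverse.to colPos (i , a)
  block : (i : Fin p) → Mat (k i)
  block i a b = P (row i a) (col i b)
  field
    upper  : (i j : Fin p) (a : Fin (k i)) (b : Fin (k j)) →
             j F.< i → P (row i a) (col j b) ≡ false
    indec  : (i : Fin p) → FullyIndecomposable (block i)
    acute  : (i : Fin p) → Acute (colSimplex (block i))

-- matrix representation of S = conv{v_0,…,v_n}: fixed vertex w = v_{i₀},
-- columns Π(v_u ⊕ w) for u ≠ i₀ in the order σ, Π given by π
matRep : {n : ℕ} → (Fin (suc n) → Fin n → Bool) → Fin (suc n) →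
         Permutation′ n → Permutation′ n → Mat n
matRep v i₀ π σ r c = v (punchIn i₀ (σ ⟨$⟩ʳ c)) (π ⟨$⟩ʳ r) xor v i₀ (π ⟨$⟩ʳ r)

ComponentsAcute : {n : ℕ} → (Fin (suc n) → Fin n → Bool) → Set
ComponentsAcute {n} v = Σ (Fin (suc n)) λ i₀ → Σ (Permutation′ n) λ π →
  Σ (Permutation′ n) λ σ → AcuteBlockForm n (matRep v i₀ π σ)

InCubeFacet : {n : ℕ} → (Fin (suc n) → Fin n → Bool) → Fin (suc n) → Set
InCubeFacet {n} v i = Σ (Fin n) λ c → Σ Bool λ b → (j : Fin (suc n)) → j ≢ i → v j c ≡ b

replace : {n : ℕ} → (Fin (suc n) → Fin n → Bool) → Fin (suc n) → (Fin n → Bool) →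
          Fin (suc n) → Fin n → Bool
replace v i w j with j ≟ i
... | yes _ = w
... | no  _ = v j

_≐_ : {n : ℕ} → (Fin n → Bool) → (Fin n → Bool) → Set
x ≐ y = ∀ c → x c ≡ y c

{-# OPTIONS --safe #-}
-- Let g_j be the gradient of the barycentric coordinate of vertex j and G = (g_j · g_l) their Gram matrix.
-- S is nonobtuse iff G has nonpositive off-diagonal entries, and G reproduces the gradients from the vertices:
--   g_j(c) = Σ_l G_lj (v_l(c) − v_j(c)).
-- All terms have the same sign, so that sign is dictated by the bit v_j(c), and g_j(c) = 0 forces v_l(c) = v_j(c)
-- whenever G_lj ≠ 0.
--
-- Acute components enter only through one consequence: orthogonal gradients have disjoint supports.  In block
-- triangular form, the part of a column above its diagonal block is a convex combination of earlier vertices,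
-- hence, being a 0/1 vector, one of them; acuteness makes it the same vertex (the root) for all columns of the
-- block.  So the gradients restricted to the rows of a block are the normals of its component (for the root and
-- the columns of the block) or zero (for all other vertices).
--
-- If w replaces v_i, the gradient of w is s g_i.  On U = supp g_i the sign rule gives w = v_i (s > 0) or its
-- complement (s < 0).  Off U, w agrees with every vertex l whose facet is not orthogonal to F in the new simplex.
-- If such an l is not orthogonal to i in S either, then w = v_i off U.  Otherwise l is the only such vertex, and
-- computing |g_i|² shows that all neighbours of i in G are complementary to v_i on U, whence U is a single
-- coordinate and F lies in a cube facet.  Hence w is v_i with the bits in U flipped.
module Submission where

open import Defs
open import Data.Nat using (ℕ; zero; suc; s<s⁻¹)
import Data.Nat.Properties as ℕₚ
open import Data.Bool using (Bool; true; false; if_then_else_; _xor_; not)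
import Data.Bool as Bool
open import Data.Fin using (Fin; zero; suc; toℕ; punchIn; punchOut; _≟_)
import Data.Fin as F
import Data.Fin.Induction as FI
import Data.Fin.Properties as Fₚ
open import Data.Fin.Properties using (any?; punchInᵢ≢i; punchIn-injective; punchIn-punchOut)
open import Data.Rational hiding (_≟_)
open import Data.Rational.Properties hiding (_≟_)
import Data.Rational.Properties as ℚ
open import Data.Rational.Solver using (module +-*-Solver)
open import Data.Vec.Functional using (insertAt)
open import Data.Vec.Functional.Properties using (insertAt-lookup; insertAt-punchIn)
open import Data.Product using (Σ; ∃; _×_; _,_; proj₁; proj₂)
open import Data.Sum using (_⊎_; inj₁; inj₂)
open import Data.Empty using (⊥; ⊥-elim)
open import Function.Bundles using (Inverse)
open import Function.Construct.Composition using (_↔-∘_)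
open import Induction.WellFounded using (Acc; acc)
open import Relation.Nullary using (¬_; yes; no)
open import Relation.Nullary.Decidable using (¬?; decidable-stable)
open import Relation.Binary.Definitions using (tri<; tri≈; tri>)
open import Relation.Binary.PropositionalEquality
open +-*-Solver using (solve; _:+_; _:*_; _:-_; :-_; _:=_; con)

-- Finite sums and linear algebra over ℚ

δ : {n : ℕ} → Fin n → Fin n → ℚ
δ zero    zero    = 1ℚ
δ zero    (suc j) = 0ℚ
δ (suc i) zero    = 0ℚ
δ (suc i) (suc j) = δ i j

δ-refl : ∀ {n} (i : Fin n) → δ i i ≡ 1ℚ
δ-refl zero    = refl
δ-refl (suc i) = δ-refl i

δ-≡ : ∀ {n} {i j : Fin n} → i ≡ j → δ i j ≡ 1ℚ
δ-≡ {i = i} refl = δ-refl i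

δ-≢ : ∀ {n} {i j : Fin n} → i ≢ j → δ i j ≡ 0ℚ
δ-≢ {i = zero}  {zero}  p = ⊥-elim (p refl)
δ-≢ {i = zero}  {suc j} p = refl
δ-≢ {i = suc i} {zero}  p = refl
δ-≢ {i = suc i} {suc j} p = δ-≢ (λ e → p (cong suc e))

δ-sym : ∀ {n} (i j : Fin n) → δ i j ≡ δ j i
δ-sym zero    zero    = refl
δ-sym zero    (suc j) = refl
δ-sym (suc i) zero    = refl
δ-sym (suc i) (suc j) = δ-sym i j

0≤1 : 0ℚ ≤ 1ℚ
0≤1 = nonNegative⁻¹ 1ℚ

0<1 : 0ℚ < 1ℚ
0<1 = positive⁻¹ 1ℚ

Σ-cong : ∀ {n} {f g : Fin n → ℚ} → (∀ i → f i ≡ g i) → Σ[ f ] ≡ Σ[ g ]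
Σ-cong {zero}  p = refl
Σ-cong {suc n} p = cong₂ _+_ (p zero) (Σ-cong (λ i → p (suc i)))

Σ-zero : ∀ {n} {f : Fin n → ℚ} → (∀ i → f i ≡ 0ℚ) → Σ[ f ] ≡ 0ℚ
Σ-zero {zero}  p = refl
Σ-zero {suc n} p = trans (cong₂ _+_ (p zero) (Σ-zero (λ i → p (suc i)))) (+-identityˡ 0ℚ)

Σ-+ : ∀ {n} (f g : Fin n → ℚ) → Σ[ (λ i → f i + g i) ] ≡ Σ[ f ] + Σ[ g ]
Σ-+ {zero}  f g = refl
Σ-+ {suc n} f g = trans (cong (f zero + g zero +_) (Σ-+ (λ i → f (suc i)) (λ i → g (suc i))))
  (solve 4 (λ a b c d → (a :+ b) :+ (c :+ d) := (a :+ c) :+ (b :+ d)) refl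
    (f zero) (g zero) Σ[ (λ i → f (suc i)) ] Σ[ (λ i → g (suc i)) ])

Σ-*ˡ : ∀ {n} (a : ℚ) (f : Fin n → ℚ) → Σ[ (λ i → a * f i) ] ≡ a * Σ[ f ]
Σ-*ˡ {zero}  a f = sym (*-zeroʳ a)
Σ-*ˡ {suc n} a f = trans (cong (a * f zero +_) (Σ-*ˡ a (λ i → f (suc i))))
  (sym (*-distribˡ-+ a (f zero) Σ[ (λ i → f (suc i)) ]))

Σ-*ʳ : ∀ {n} (f : Fin n → ℚ) (a : ℚ) → Σ[ (λ i → f i * a) ] ≡ Σ[ f ] * a
Σ-*ʳ f a = trans (Σ-cong (λ i → *-comm (f i) a)) (trans (Σ-*ˡ a f) (*-comm a Σ[ f ]))

Σ-neg : ∀ {n} (f : Fin n → ℚ) → Σ[ (λ i → - f i) ] ≡ - Σ[ f ]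
Σ-neg {zero}  f = refl
Σ-neg {suc n} f = trans (cong (- f zero +_) (Σ-neg (λ i → f (suc i))))
  (sym (neg-distrib-+ (f zero) Σ[ (λ i → f (suc i)) ]))

Σ-- : ∀ {n} (f g : Fin n → ℚ) → Σ[ (λ i → f i - g i) ] ≡ Σ[ f ] - Σ[ g ]
Σ-- f g = trans (Σ-+ f (λ i → - g i)) (cong (Σ[ f ] +_) (Σ-neg g))

Σ-swap : ∀ {m n} (f : Fin m → Fin n → ℚ) →
  Σ[ (λ i → Σ[ f i ]) ] ≡ Σ[ (λ j → Σ[ (λ i → f i j) ]) ]
Σ-swap {zero}  {n} f = sym (Σ-zero {n} (λ _ → refl))
Σ-swap {suc m} f = trans (cong (Σ[ f zero ] +_) (Σ-swap (λ i → f (suc i))))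
  (sym (Σ-+ (f zero) (λ j → Σ[ (λ i → f (suc i) j) ])))

Σ-δ : ∀ {n} (j : Fin n) (f : Fin n → ℚ) → Σ[ (λ i → δ j i * f i) ] ≡ f j
Σ-δ zero f = trans (cong₂ _+_ (*-identityˡ (f zero)) (Σ-zero (λ i → *-zeroˡ (f (suc i)))))
  (+-identityʳ (f zero))
Σ-δ (suc j) f = trans (cong₂ _+_ (*-zeroˡ (f zero)) (Σ-δ j (λ i → f (suc i))))
  (+-identityˡ (f (suc j)))

Σ-δʳ : ∀ {n} (j : Fin n) (f : Fin n → ℚ) → Σ[ (λ i → f i * δ i j) ] ≡ f j
Σ-δʳ j f = trans (Σ-cong (λ i → trans (*-comm (f i) (δ i j)) (cong (_* f i) (δ-sym i j)))) (Σ-δ j f)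

Σ-punchIn : ∀ {n} (j : Fin (suc n)) (f : Fin (suc n) → ℚ) →
  Σ[ f ] ≡ f j + Σ[ (λ i → f (punchIn j i)) ]
Σ-punchIn zero f = refl
Σ-punchIn {suc n} (suc j) f = trans (cong (f zero +_) (Σ-punchIn j (λ i → f (suc i))))
  (solve 3 (λ a b c → a :+ (b :+ c) := b :+ (a :+ c)) refl
    (f zero) (f (suc j)) Σ[ (λ i → f (suc (punchIn j i))) ])

Σ-nonneg : ∀ {n} {f : Fin n → ℚ} → (∀ i → 0ℚ ≤ f i) → 0ℚ ≤ Σ[ f ]
Σ-nonneg {zero}  p = ≤-refl
Σ-nonneg {suc n} p = +-mono-≤ (p zero) (Σ-nonneg (λ i → p (suc i)))

Σ-mono : ∀ {n} {f g : Fin n → ℚ} → (∀ i → f i ≤ g i) → Σ[ f ] ≤ Σ[ g ]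
Σ-mono {zero}  p = ≤-refl
Σ-mono {suc n} p = +-mono-≤ (p zero) (Σ-mono (λ i → p (suc i)))

Σ-nonpos : ∀ {n} {f : Fin n → ℚ} → (∀ i → f i ≤ 0ℚ) → Σ[ f ] ≤ 0ℚ
Σ-nonpos {n} p = ≤-trans (Σ-mono p) (≤-reflexive (Σ-zero {n} (λ _ → refl)))

Σ-pos : ∀ {n} {f : Fin n → ℚ} → (∀ i → 0ℚ ≤ f i) → ∀ j → 0ℚ < f j → 0ℚ < Σ[ f ]
Σ-pos {suc n} p zero    q = +-mono-<-≤ q (Σ-nonneg (λ i → p (suc i)))
Σ-pos {suc n} p (suc j) q = +-mono-≤-< (p zero) (Σ-pos (λ i → p (suc i)) j q)

Σ-neg< : ∀ {n} {f : Fin n → ℚ} → (∀ i → f i ≤ 0ℚ) → ∀ j → f j < 0ℚ → Σ[ f ] < 0ℚ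
Σ-neg< {suc n} p zero    q = +-mono-<-≤ q (Σ-nonpos (λ i → p (suc i)))
Σ-neg< {suc n} p (suc j) q = +-mono-≤-< (p zero) (Σ-neg< (λ i → p (suc i)) j q)

≤∧≢⇒< : ∀ {p q} → p ≤ q → p ≢ q → p < q
≤∧≢⇒< {p} {q} p≤q p≢q with p <? q
... | yes r = r
... | no  r = ⊥-elim (p≢q (≤-antisym p≤q (≮⇒≥ r)))

Σ-nonneg-0 : ∀ {n} {f : Fin n → ℚ} → (∀ i → 0ℚ ≤ f i) → Σ[ f ] ≡ 0ℚ → ∀ i → f i ≡ 0ℚ
Σ-nonneg-0 {f = f} p e i with f i ℚ.≟ 0ℚ
... | yes q = q
... | no  q = ⊥-elim (<⇒≢ (Σ-pos p i (≤∧≢⇒< (p i) (λ r → q (sym r)))) (sym e))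

Σ-≢0 : ∀ {n} (f : Fin n → ℚ) → Σ[ f ] ≢ 0ℚ → ∃ λ i → f i ≢ 0ℚ
Σ-≢0 f p with any? (λ i → ¬? (f i ℚ.≟ 0ℚ))
... | yes q = q
... | no  q = ⊥-elim (p (Σ-zero (λ i → decidable-stable (f i ℚ.≟ 0ℚ) (λ r → q (i , r)))))

*-nonneg : ∀ {p q} → 0ℚ ≤ p → 0ℚ ≤ q → 0ℚ ≤ p * q
*-nonneg {p} {q} a b =
  nonNegative⁻¹ (p * q) {{nonNeg*nonNeg⇒nonNeg p {{nonNegative a}} q {{nonNegative b}}}}

*-nonpos² : ∀ {p q} → p ≤ 0ℚ → q ≤ 0ℚ → 0ℚ ≤ p * q
*-nonpos² {p} {q} a b =
  nonNegative⁻¹ (p * q) {{nonPos*nonPos⇒nonPos p {{nonPositive a}} q {{nonPositive b}}}}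

*-nonpos-nonneg : ∀ {p q} → p ≤ 0ℚ → 0ℚ ≤ q → p * q ≤ 0ℚ
*-nonpos-nonneg {p} {q} a b =
  nonPositive⁻¹ (p * q) {{nonPos*nonNeg⇒nonPos p {{nonPositive a}} q {{nonNegative b}}}}

*-neg² : ∀ {p q} → p < 0ℚ → q < 0ℚ → 0ℚ < p * q
*-neg² {p} {q} a b =
  positive⁻¹ (p * q) {{neg*neg⇒pos p {{negative a}} q {{negative b}}}}

p*q≡0 : ∀ p q → p * q ≡ 0ℚ → p ≢ 0ℚ → q ≡ 0ℚ
p*q≡0 p q e p≢0 = begin
  q                  ≡⟨ sym (*-identityˡ q) ⟩
  1ℚ * q             ≡⟨ cong (_* q) (sym (*-inverseˡ p)) ⟩
  (1/ p) * p * q     ≡⟨ *-assoc (1/ p) p q ⟩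
  (1/ p) * (p * q)   ≡⟨ cong ((1/ p) *_) e ⟩
  (1/ p) * 0ℚ        ≡⟨ *-zeroʳ (1/ p) ⟩
  0ℚ                 ∎
  where open ≡-Reasoning
        instance _ = ≢-nonZero p≢0

Family : ℕ → ℕ → Set
Family m n = Fin m → Fin n → ℚ

Relation₀ : ∀ {m n} → Family m n → (Fin m → ℚ) → Set
Relation₀ u μ = ∀ c → Σ[ (λ j → μ j * u j c) ] ≡ 0ℚ

Independent : ∀ {m n} → Family m n → Set
Independent u = ∀ μ → Relation₀ u μ → ∀ j → μ j ≡ 0ℚ

-- Gaussian elimination on the first coordinate. If it vanishes throughout, it is dropped together
-- with the first vector; otherwise a pivot clears it from the other vectors. Either way one vector
-- and one coordinate disappear.
dependent : ∀ m (u : Family (suc m) m) → ∃ λ μ → Relation₀ u μ × ∃ λ j → μ j ≢ 0ℚ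
dependent zero u = (λ _ → 1ℚ) , (λ ()) , zero , 1≢0
dependent (suc m) u with any? (λ j → ¬? (u j zero ℚ.≟ 0ℚ))
... | no none = μ , rel , suc j , nz
  where
  ih = dependent m (λ j c → u (suc j) (suc c))
  j = proj₁ (proj₂ (proj₂ ih))
  nz = proj₂ (proj₂ (proj₂ ih))
  μ : Fin (suc (suc m)) → ℚ
  μ zero    = 0ℚ
  μ (suc j) = proj₁ ih j
  rel : Relation₀ u μ
  rel zero = Σ-zero (λ j → trans
    (cong (μ j *_) (decidable-stable (u j zero ℚ.≟ 0ℚ) (λ r → none (j , r)))) (*-zeroʳ (μ j)))
  rel (suc c) = trans (cong₂ _+_ (*-zeroˡ (u zero (suc c))) (proj₁ (proj₂ ih) c)) (+-identityˡ 0ℚ)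
... | yes (k , p≢0) = μ , rel , punchIn k j , nz′
  where
  p = u k zero
  u′ : Family (suc m) (suc m)
  -- Elimination without division: each vector is scaled by the pivot, so coordinate zero of `u′ j`
  -- cancels.
  u′ j c = p * u (punchIn k j) c - u (punchIn k j) zero * u k c
  ih = dependent m (λ j c → u′ j (suc c))
  ν = proj₁ ih
  j = proj₁ (proj₂ (proj₂ ih))
  nz = proj₂ (proj₂ (proj₂ ih))
  νu pν : Fin (suc m) → ℚ
  νu j = ν j * u (punchIn k j) zero
  pν j = p * ν j
  t = Σ[ νu ]
  μ : Fin (suc (suc m)) → ℚ
  μ = insertAt pν k (- t)
  nz′ : μ (punchIn k j) ≢ 0ℚ
  nz′ e = nz (p*q≡0 p (ν j) (trans (sym (insertAt-punchIn pν k (- t) j)) e) p≢0)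
  expand : ∀ c → Σ[ (λ j → μ j * u j c) ] ≡ Σ[ (λ j → ν j * u′ j c) ]
  expand c = begin
    Σ[ (λ j → μ j * u j c) ]
      ≡⟨ Σ-punchIn k (λ j → μ j * u j c) ⟩
    μ k * u k c + Σ[ (λ j → μ (punchIn k j) * u (punchIn k j) c) ]
      ≡⟨ cong₂ _+_ (trans (cong (_* u k c) (trans (insertAt-lookup pν k (- t)) (sym (Σ-neg νu))))
                          (sym (Σ-*ʳ (λ j → - νu j) (u k c))))
                   (Σ-cong (λ j → cong (_* u (punchIn k j) c) (insertAt-punchIn pν k (- t) j))) ⟩
    Σ[ (λ j → - νu j * u k c) ] + Σ[ (λ j → pν j * u (punchIn k j) c) ]
      ≡⟨ sym (Σ-+ (λ j → - νu j * u k c) (λ j → pν j * u (punchIn k j) c)) ⟩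
    Σ[ (λ j → - νu j * u k c + pν j * u (punchIn k j) c) ]
      ≡⟨ Σ-cong (λ j → solve 5 (λ n a b p d → (:- (n :* a)) :* b :+ p :* n :* d := n :* (p :* d :- a :* b))
           refl (ν j) (u (punchIn k j) zero) (u k c) p (u (punchIn k j) c)) ⟩
    Σ[ (λ j → ν j * u′ j c) ] ∎
    where open ≡-Reasoning
  rel : Relation₀ u μ
  rel zero = trans (expand zero) (Σ-zero (λ j →
    solve 3 (λ n p a → n :* (p :* a :- a :* p) := con 0ℚ) refl (ν j) p (u (punchIn k j) zero)))
  rel (suc c) = trans (expand (suc c)) (proj₁ (proj₂ ih) c)

-- Apply `dependent` to `δ d` together with the family: independence forces a nonzero coefficient on
-- `δ d`, and the relation is solved for it.
independent⇒spanning : ∀ {m} (u : Family m m) → Independent u → ∀ d →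
  ∃ λ α → ∀ c → Σ[ (λ j → α j * u j c) ] ≡ δ d c
independent⇒spanning {m} u ind d = α , αu
  where
  w : Family (suc m) m
  w zero    = δ d
  w (suc j) = u j
  rel = dependent m w
  μ = proj₁ rel
  μ₀≢0 : μ zero ≢ 0ℚ
  μ₀≢0 e = all-zero (proj₁ (proj₂ (proj₂ rel))) (proj₂ (proj₂ (proj₂ rel)))
    where
    ν≡0 : ∀ j → μ (suc j) ≡ 0ℚ
    ν≡0 = ind (λ j → μ (suc j)) (λ c → trans (sym (trans
      (cong (λ z → z * δ d c + Σ[ (λ j → μ (suc j) * u j c) ]) e)
      (trans (cong (_+ Σ[ (λ j → μ (suc j) * u j c) ]) (*-zeroˡ (δ d c))) (+-identityˡ Σ[ (λ j → μ (suc j) * u j c) ]))))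
      (proj₁ (proj₂ rel) c))
    all-zero : ∀ j → μ j ≢ 0ℚ → ⊥
    all-zero zero    p = p e
    all-zero (suc j) p = p (ν≡0 j)
  instance _ = ≢-nonZero μ₀≢0
  α : Fin m → ℚ
  α j = - (1/ μ zero) * μ (suc j)
  αu : ∀ c → Σ[ (λ j → α j * u j c) ] ≡ δ d c
  αu c = begin
    Σ[ (λ j → α j * u j c) ]
      ≡⟨ Σ-cong (λ j → *-assoc (- (1/ μ zero)) (μ (suc j)) (u j c)) ⟩
    Σ[ (λ j → - (1/ μ zero) * (μ (suc j) * u j c)) ]
      ≡⟨ Σ-*ˡ (- (1/ μ zero)) (λ j → μ (suc j) * u j c) ⟩
    - (1/ μ zero) * s
      ≡⟨ solve 4 (λ r m e s → (:- r) :* s := r :* m :* e :- r :* (m :* e :+ s)) refl (1/ μ zero) (μ zero) (δ d c) s ⟩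
    (1/ μ zero) * μ zero * δ d c - (1/ μ zero) * (μ zero * δ d c + s)
      ≡⟨ cong₂ (λ a b → a * δ d c - (1/ μ zero) * b) (*-inverseˡ (μ zero)) (proj₁ (proj₂ rel) c) ⟩
    1ℚ * δ d c - (1/ μ zero) * 0ℚ
      ≡⟨ solve 2 (λ r e → con 1ℚ :* e :- r :* con 0ℚ := e) refl (1/ μ zero) (δ d c) ⟩
    δ d c ∎
    where
    open ≡-Reasoning
    s = Σ[ (λ j → μ (suc j) * u j c) ]

-- Expanding the unit vectors gives an inverse on one side. For the other side, the coefficients `b`
-- and `δ i k` both express `u k` through the family, so independence identifies them.
independent⇒inverse : ∀ {m} (u : Family m m) → Independent u → ∃ λ (N : Family m m) →
  (∀ d c → Σ[ (λ j → N j d * u j c) ] ≡ δ d c) × (∀ j k → Σ[ (λ d → N j d * u k d) ] ≡ δ j k)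
independent⇒inverse {m} u ind = N , NᵀU , NUᵀ
  where
  N : Family m m
  N j d = proj₁ (independent⇒spanning u ind d) j
  NᵀU : ∀ d c → Σ[ (λ j → N j d * u j c) ] ≡ δ d c
  NᵀU d = proj₂ (independent⇒spanning u ind d)
  NUᵀ : ∀ j k → Σ[ (λ d → N j d * u k d) ] ≡ δ j k
  NUᵀ j k = begin
    b j                   ≡⟨ solve 2 (λ x y → x := (x :- y) :+ y) refl (b j) (δ j k) ⟩
    (b j - δ j k) + δ j k ≡⟨ cong (_+ δ j k) (ind (λ i → b i - δ i k) rel j) ⟩
    0ℚ + δ j k            ≡⟨ +-identityˡ (δ j k) ⟩
    δ j k                 ∎
    where
    open ≡-Reasoning
    b : Fin m → ℚ
    b i = Σ[ (λ d → N i d * u k d) ]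
    rel : Relation₀ u (λ i → b i - δ i k)
    rel c = begin
      Σ[ (λ i → (b i - δ i k) * u i c) ]
        ≡⟨ Σ-cong (λ i → solve 3 (λ x y z → (x :- y) :* z := x :* z :- z :* y) refl (b i) (δ i k) (u i c)) ⟩
      Σ[ (λ i → b i * u i c - u i c * δ i k) ]
        ≡⟨ Σ-- (λ i → b i * u i c) (λ i → u i c * δ i k) ⟩
      Σ[ (λ i → b i * u i c) ] - Σ[ (λ i → u i c * δ i k) ]
        ≡⟨ cong₂ _-_ (trans (Σ-cong (λ i → sym (Σ-*ʳ (λ d → N i d * u k d) (u i c))))
                            (Σ-swap (λ i d → N i d * u k d * u i c)))
                      (Σ-δʳ k (λ i → u i c)) ⟩
      Σ[ (λ d → Σ[ (λ i → N i d * u k d * u i c) ]) ] - u k c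
        ≡⟨ cong (_- u k c) (Σ-cong (λ d → trans
             (Σ-cong (λ i → solve 3 (λ x y z → x :* y :* z := y :* (x :* z)) refl (N i d) (u k d) (u i c)))
             (trans (Σ-*ˡ (u k d) (λ i → N i d * u i c)) (cong (u k d *_) (NᵀU d c))))) ⟩
      Σ[ (λ d → u k d * δ d c) ] - u k c
        ≡⟨ cong (_- u k c) (Σ-δʳ c (u k)) ⟩
      u k c - u k c
        ≡⟨ +-inverseʳ (u k c) ⟩
      0ℚ ∎

-- Barycentric gradients

-- Lets inner products within one block be computed in the full space, with an indicator weight.
Σ-image : ∀ {k n q} (row : Fin k → Fin n) (lev : Fin n → Fin q) (L : Fin q) →
  (∀ {a b} → row a ≡ row b → a ≡ b) → (∀ a → lev (row a) ≡ L) → (∀ c → lev c ≡ L → ∃ λ a → row a ≡ c) →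
  (f : Fin n → ℚ) → Σ[ (λ a → f (row a)) ] ≡ Σ[ (λ c → δ L (lev c) * f c) ]
Σ-image row lev L inj on sur f = begin
  Σ[ (λ a → f (row a)) ]
    ≡⟨ Σ-cong (λ a → sym (Σ-δ (row a) f)) ⟩
  Σ[ (λ a → Σ[ (λ c → δ (row a) c * f c) ]) ]
    ≡⟨ Σ-swap (λ a c → δ (row a) c * f c) ⟩
  Σ[ (λ c → Σ[ (λ a → δ (row a) c * f c) ]) ]
    ≡⟨ Σ-cong (λ c → trans (Σ-*ʳ (λ a → δ (row a) c) (f c)) (cong (_* f c) (count c))) ⟩
  Σ[ (λ c → δ L (lev c) * f c) ] ∎
  where
  open ≡-Reasoning
  count : ∀ c → Σ[ (λ a → δ (row a) c) ] ≡ δ L (lev c)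
  count c with lev c ≟ L
  ... | no p = trans (Σ-zero (λ a → δ-≢ {i = row a} {c} (λ e → p (trans (cong lev (sym e)) (on a)))))
                     (sym (δ-≢ (λ e → p (sym e))))
  ... | yes p with sur c p
  ...   | a₀ , refl = trans (Σ-cong δ-row) (trans (Σ-δʳ a₀ (λ _ → 1ℚ)) (sym (δ-≡ (sym p))))
    where
    δ-row : ∀ a → δ (row a) (row a₀) ≡ 1ℚ * δ a a₀
    δ-row a with a ≟ a₀
    ... | yes refl = trans (δ-refl (row a)) (sym (trans (*-identityˡ (δ a a)) (δ-refl a)))
    ... | no  ne   = trans (δ-≢ (λ e → ne (inj e))) (sym (trans (*-identityˡ (δ a a₀)) (δ-≢ ne)))

dot-comm : ∀ {n} (x y : Fin n → ℚ) → dot x y ≡ dot y x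
dot-comm x y = Σ-cong (λ c → *-comm (x c) (y c))

dot-⊖ : ∀ {n} (h x y : Fin n → ℚ) → dot h (x ⊖ y) ≡ dot h x - dot h y
dot-⊖ h x y = trans
  (Σ-cong (λ c → solve 3 (λ a b c → a :* (b :- c) := a :* b :- a :* c) refl (h c) (x c) (y c)))
  (Σ-- (λ c → h c * x c) (λ c → h c * y c))

dot-0 : ∀ {n} {h x : Fin n → ℚ} → (∀ c → x c ≡ 0ℚ) → dot h x ≡ 0ℚ
dot-0 {h = h} p = Σ-zero (λ c → trans (cong (h c *_) (p c)) (*-zeroʳ (h c)))

dot-congʳ : ∀ {n} {h x y : Fin n → ℚ} → (∀ c → x c ≡ y c) → dot h x ≡ dot h y
dot-congʳ {h = h} p = Σ-cong (λ c → cong (h c *_) (p c))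

dot-Σ : ∀ {m n} (h : Fin n → ℚ) (α : Fin m → ℚ) (u : Family m n) →
  dot h (λ d → Σ[ (λ j → α j * u j d) ]) ≡ Σ[ (λ j → α j * dot h (u j)) ]
dot-Σ h α u = begin
  Σ[ (λ d → h d * Σ[ (λ j → α j * u j d) ]) ]
    ≡⟨ Σ-cong (λ d → sym (Σ-*ˡ (h d) (λ j → α j * u j d))) ⟩
  Σ[ (λ d → Σ[ (λ j → h d * (α j * u j d)) ]) ]
    ≡⟨ Σ-swap (λ d j → h d * (α j * u j d)) ⟩
  Σ[ (λ j → Σ[ (λ d → h d * (α j * u j d)) ]) ]
    ≡⟨ Σ-cong (λ j → trans
         (Σ-cong (λ d → solve 3 (λ a b c → a :* (b :* c) := b :* (a :* c)) refl (h d) (α j) (u j d)))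
         (Σ-*ˡ (α j) (λ d → h d * u j d))) ⟩
  Σ[ (λ j → α j * dot h (u j)) ] ∎
  where open ≡-Reasoning

-- x ↦ dot (g j) x + κ j is the barycentric coordinate function of vertex j.
record Dual {n : ℕ} (x : Family (suc n) n) : Set where
  field
    g    : Family (suc n) n
    κ    : Fin (suc n) → ℚ
    dual : ∀ j k → dot (g j) (x k) + κ j ≡ δ j k
    Σg   : ∀ c → Σ[ (λ j → g j c) ] ≡ 0ℚ
    Σgx  : ∀ c d → Σ[ (λ j → g j c * x j d) ] ≡ δ c d
    Σκ   : Σ[ κ ] ≡ 1ℚ
    Σκx  : ∀ c → Σ[ (λ j → κ j * x j c) ] ≡ 0ℚ

-- Affine independence is linear independence of the vectors `(1, x j)`. In the inverse matrix the
-- column of the extra coordinate holds the constants, the other columns hold the gradients.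
affInd⇒Dual : ∀ {n} (x : Family (suc n) n) → AffInd x → Dual x
affInd⇒Dual {n} x ai = record
  { g    = λ j c → N j (suc c)
  ; κ    = λ j → N j zero
  ; dual = λ j k → trans (solve 2 (λ a b → a :+ b := b :* con 1ℚ :+ a) refl
             (dot (λ c → N j (suc c)) (x k)) (N j zero)) (NUᵀ j k)
  ; Σg   = λ c → trans (unit (λ j → N j (suc c))) (NᵀU (suc c) zero)
  ; Σgx  = λ c d → NᵀU (suc c) (suc d)
  ; Σκ   = trans (unit (λ j → N j zero)) (NᵀU zero zero)
  ; Σκx  = λ c → NᵀU zero (suc c)
  }
  where
  u : Family (suc n) (suc n)
  u j zero    = 1ℚ
  u j (suc c) = x j c
  unit : (f : Fin (suc n) → ℚ) → Σ[ f ] ≡ Σ[ (λ j → f j * 1ℚ) ]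
  unit f = Σ-cong (λ j → sym (*-identityʳ (f j)))
  inverse = independent⇒inverse u (λ μ rel → ai μ (trans (unit μ) (rel zero)) (λ c → rel (suc c)))
  N = proj₁ inverse
  NᵀU = proj₁ (proj₂ inverse)
  NUᵀ = proj₂ (proj₂ inverse)

affine-⊖ : ∀ {n} (γ : Fin n → ℚ) κ (y z : Fin n → ℚ) {a b} →
  dot γ y + κ ≡ a → dot γ z + κ ≡ b → dot γ (y ⊖ z) ≡ a - b
affine-⊖ γ κ y z p q = trans (dot-⊖ γ y z) (trans
  (solve 3 (λ a b c → a :- b := (a :+ c) :- (b :+ c)) refl (dot γ y) (dot γ z) κ) (cong₂ _-_ p q))

dual⇒inwardNormal : ∀ {m} (x : Family (suc m) m) i γ κ →
  (∀ k → dot γ (x k) + κ ≡ δ i k) → IsInwardNormal x i γ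
dual⇒inwardNormal x i γ κ h = flat , inward
  where
  diff : ∀ j k → dot γ (x j ⊖ x k) ≡ δ i j - δ i k
  diff j k = affine-⊖ γ κ (x j) (x k) (h j) (h k)
  flat : ∀ j k → j ≢ i → k ≢ i → dot γ (x j ⊖ x k) ≡ 0ℚ
  flat j k p q = trans (diff j k) (cong₂ _-_ (δ-≢ (λ e → p (sym e))) (δ-≢ (λ e → q (sym e))))
  inward : ∀ k → k ≢ i → 0ℚ < dot γ (x i ⊖ x k)
  inward k q = subst (0ℚ <_) (sym (trans (diff i k) (cong₂ _-_ (δ-refl i) (δ-≢ (λ e → q (sym e)))))) 0<1

module DualProperties {n : ℕ} {x : Family (suc n) n} (D : Dual x) where
  open Dual D public

  β : Fin (suc n) → (Fin n → ℚ) → ℚ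
  β j y = dot (g j) y + κ j

  gram : Fin (suc n) → Fin (suc n) → ℚ
  gram j l = dot (g j) (g l)

  -- `Σgx` is a resolution of the identity, contracted here with `h` on the vertex side and in
  -- `expandʳ` on the gradient side. The latter, with a gradient for `z`, recovers it from the Gram
  -- matrix.
  expandˡ : ∀ h c → Σ[ (λ l → dot h (x l) * g l c) ] ≡ h c
  expandˡ h c = begin
    Σ[ (λ l → dot h (x l) * g l c) ]
      ≡⟨ Σ-cong (λ l → sym (Σ-*ʳ (λ d → h d * x l d) (g l c))) ⟩
    Σ[ (λ l → Σ[ (λ d → h d * x l d * g l c) ]) ]
      ≡⟨ Σ-swap (λ l d → h d * x l d * g l c) ⟩
    Σ[ (λ d → Σ[ (λ l → h d * x l d * g l c) ]) ]
      ≡⟨ Σ-cong (λ d → trans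
           (Σ-cong (λ l → solve 3 (λ a b e → a :* b :* e := a :* (e :* b)) refl (h d) (x l d) (g l c)))
           (trans (Σ-*ˡ (h d) (λ l → g l c * x l d)) (trans (cong (h d *_) (Σgx c d)) (*-comm (h d) (δ c d))))) ⟩
    Σ[ (λ d → δ c d * h d) ]
      ≡⟨ Σ-δ c h ⟩
    h c ∎
    where open ≡-Reasoning

  expandʳ : ∀ z c → Σ[ (λ l → dot (g l) z * x l c) ] ≡ z c
  expandʳ z c = begin
    Σ[ (λ l → dot (g l) z * x l c) ]
      ≡⟨ Σ-cong (λ l → sym (Σ-*ʳ (λ d → g l d * z d) (x l c))) ⟩
    Σ[ (λ l → Σ[ (λ d → g l d * z d * x l c) ]) ]
      ≡⟨ Σ-swap (λ l d → g l d * z d * x l c) ⟩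
    Σ[ (λ d → Σ[ (λ l → g l d * z d * x l c) ]) ]
      ≡⟨ Σ-cong (λ d → trans
           (Σ-cong (λ l → solve 3 (λ a b e → a :* b :* e := b :* (a :* e)) refl (g l d) (z d) (x l c)))
           (trans (Σ-*ˡ (z d) (λ l → g l d * x l c)) (cong (z d *_) (Σgx d c)))) ⟩
    Σ[ (λ d → z d * δ d c) ]
      ≡⟨ Σ-δʳ c z ⟩
    z c ∎
    where open ≡-Reasoning

  expand-dot : ∀ h z → Σ[ (λ l → dot h (x l) * dot (g l) z) ] ≡ dot h z
  expand-dot h z = begin
    Σ[ (λ l → dot h (x l) * dot (g l) z) ]
      ≡⟨ Σ-cong (λ l → cong (dot h (x l) *_) (dot-comm (g l) z)) ⟩
    Σ[ (λ l → dot h (x l) * dot z (g l)) ]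
      ≡⟨ sym (dot-Σ z (λ l → dot h (x l)) g) ⟩
    dot z (λ d → Σ[ (λ l → dot h (x l) * g l d) ])
      ≡⟨ dot-congʳ {h = z} (expandˡ h) ⟩
    dot z h
      ≡⟨ dot-comm z h ⟩
    dot h z ∎
    where open ≡-Reasoning

  Σ-dot : ∀ z → Σ[ (λ l → dot (g l) z) ] ≡ 0ℚ
  Σ-dot z = begin
    Σ[ (λ l → Σ[ (λ d → g l d * z d) ]) ]
      ≡⟨ Σ-swap (λ l d → g l d * z d) ⟩
    Σ[ (λ d → Σ[ (λ l → g l d * z d) ]) ]
      ≡⟨ Σ-zero (λ d → trans (Σ-*ʳ (λ l → g l d) (z d)) (trans (cong (_* z d) (Σg d)) (*-zeroˡ (z d)))) ⟩
    0ℚ ∎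
    where open ≡-Reasoning

  Σβ : ∀ y → Σ[ (λ j → β j y) ] ≡ 1ℚ
  Σβ y = trans (Σ-+ (λ j → dot (g j) y) κ) (cong₂ _+_ (Σ-dot y) Σκ)

  Σβx : ∀ y c → Σ[ (λ j → β j y * x j c) ] ≡ y c
  Σβx y c = begin
    Σ[ (λ j → β j y * x j c) ]
      ≡⟨ Σ-cong (λ j → *-distribʳ-+ (x j c) (dot (g j) y) (κ j)) ⟩
    Σ[ (λ j → dot (g j) y * x j c + κ j * x j c) ]
      ≡⟨ Σ-+ (λ j → dot (g j) y * x j c) (λ j → κ j * x j c) ⟩
    Σ[ (λ j → dot (g j) y * x j c) ] + Σ[ (λ j → κ j * x j c) ]
      ≡⟨ cong₂ _+_ (expandʳ y c) (Σκx c) ⟩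
    y c + 0ℚ
      ≡⟨ +-identityʳ (y c) ⟩
    y c ∎
    where open ≡-Reasoning

  dual-⊖ : ∀ i j k → dot (g i) (x j ⊖ x k) ≡ δ i j - δ i k
  dual-⊖ i j k = affine-⊖ (g i) (κ i) (x j) (x k) (dual i j) (dual i k)

-- Bits, signs and the gradients of a nonobtuse 0/1-simplex

η : Bool → ℚ
η b = if b then - 1ℚ else 1ℚ

η² : ∀ b → η b * η b ≡ 1ℚ
η² true  = refl
η² false = refl

η≢0 : ∀ b → η b ≢ 0ℚ
η≢0 true  ()
η≢0 false ()

toℚ-xor : ∀ a b → toℚ (a xor b) ≡ η b * (toℚ a - toℚ b)
toℚ-xor true  true  = refl
toℚ-xor true  false = refl
toℚ-xor false true  = refl
toℚ-xor false false = refl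

toℚ-nonneg : ∀ b → 0ℚ ≤ toℚ b
toℚ-nonneg true  = 0≤1
toℚ-nonneg false = ≤-refl

toℚ-injective : ∀ {a b} → toℚ a ≡ toℚ b → a ≡ b
toℚ-injective {true}  {true}  _ = refl
toℚ-injective {false} {false} _ = refl
toℚ-injective {true}  {false} ()
toℚ-injective {false} {true}  ()

xor-self : ∀ b → b xor b ≡ false
xor-self true  = refl
xor-self false = refl

xor-≡ : ∀ {a b} → a xor b ≡ false → a ≡ b
xor-≡ {true}  {true}  _ = refl
xor-≡ {false} {false} _ = refl
xor-≡ {true}  {false} ()
xor-≡ {false} {true}  ()

-- Fixes one concrete choice of normals, so that nonobtuseness can be carried to a reflected simplex
-- without returning to affine independence.
record NonobtuseDual {n : ℕ} (v : Fin (suc n) → Fin n → Bool) : Set where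
  field
    dualBasis : Dual (embed v)
  open DualProperties dualBasis public
  field
    gram≤0 : ∀ j l → j ≢ l → gram j l ≤ 0ℚ

nonobtuseDual : ∀ {n} (v : Fin (suc n) → Fin n → Bool) →
  Is01Simplex v → Nonobtuse (embed v) → NonobtuseDual v
nonobtuseDual v simplex nonobtuse = record
  { dualBasis = D
  ; gram≤0    = λ j l ne → nonobtuse j l ne (g j) (g l) (normal j) (normal l)
  }
  where
  D = affInd⇒Dual (embed v) simplex
  open Dual D
  normal : ∀ j → IsInwardNormal (embed v) j (g j)
  normal j = dual⇒inwardNormal (embed v) j (g j) (κ j) (dual j)

module NonobtuseProperties {n : ℕ} {v : Fin (suc n) → Fin n → Bool} (S : NonobtuseDual v) where
  open NonobtuseDual S public

  private x = embed v

  -- By `toℚ-xor` this is `expandʳ` for `g j`; the constant `b` contributes nothing because the Gram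
  -- entries in a column sum to zero.
  signed-gradient : ∀ j c b → Σ[ (λ l → gram l j * toℚ (v l c xor b)) ] ≡ η b * g j c
  signed-gradient j c b = begin
    Σ[ (λ l → gram l j * toℚ (v l c xor b)) ]
      ≡⟨ Σ-cong (λ l → trans (cong (gram l j *_) (toℚ-xor (v l c) b))
           (solve 4 (λ a e y z → a :* (e :* (y :- z)) := e :* (a :* y :- a :* z)) refl
             (gram l j) (η b) (x l c) (toℚ b))) ⟩
    Σ[ (λ l → η b * (gram l j * x l c - gram l j * toℚ b)) ]
      ≡⟨ Σ-*ˡ (η b) (λ l → gram l j * x l c - gram l j * toℚ b) ⟩
    η b * Σ[ (λ l → gram l j * x l c - gram l j * toℚ b) ]
      ≡⟨ cong (η b *_) (Σ-- (λ l → gram l j * x l c) (λ l → gram l j * toℚ b)) ⟩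
    η b * (Σ[ (λ l → gram l j * x l c) ] - Σ[ (λ l → gram l j * toℚ b) ])
      ≡⟨ cong (η b *_) (cong₂ _-_ (expandʳ (g j) c)
           (trans (Σ-*ʳ (λ l → gram l j) (toℚ b)) (cong (_* toℚ b) (Σ-dot (g j))))) ⟩
    η b * (g j c - 0ℚ * toℚ b)
      ≡⟨ solve 3 (λ e y z → e :* (y :- con 0ℚ :* z) := e :* y) refl (η b) (g j c) (toℚ b) ⟩
    η b * g j c ∎
    where open ≡-Reasoning

  -- Choosing the bit `v j c` kills the diagonal term, the only one whose Gram entry can be
  -- positive.
  signed-term≤0 : ∀ j c l → gram l j * toℚ (v l c xor v j c) ≤ 0ℚ
  signed-term≤0 j c l with l ≟ j
  ... | yes refl = ≤-reflexive (trans (cong (λ z → gram j j * toℚ z) (xor-self (v j c))) (*-zeroʳ (gram j j)))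
  ... | no  ne   = *-nonpos-nonneg (gram≤0 l j ne) (toℚ-nonneg (v l c xor v j c))

  gradient-sign : ∀ j c → η (v j c) * g j c ≤ 0ℚ
  gradient-sign j c = subst (_≤ 0ℚ) (signed-gradient j c (v j c)) (Σ-nonpos (signed-term≤0 j c))

  gradient≤0 : ∀ j c → v j c ≡ false → g j c ≤ 0ℚ
  gradient≤0 j c e = subst (_≤ 0ℚ) (trans (cong (λ b → η b * g j c) e) (*-identityˡ (g j c))) (gradient-sign j c)

  -- A sum of terms of one sign vanishes only if every term does.
  gradient-0 : ∀ j c l → g j c ≡ 0ℚ → gram l j ≢ 0ℚ → v l c ≡ v j c
  gradient-0 j c l e p = xor-≡ (toℚ-injective (p*q≡0 (gram l j) (toℚ (v l c xor v j c)) term≡0 p))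
    where
    Σ≡0 : Σ[ (λ l → gram l j * toℚ (v l c xor v j c)) ] ≡ 0ℚ
    Σ≡0 = trans (signed-gradient j c (v j c)) (trans (cong (η (v j c) *_) e) (*-zeroʳ (η (v j c))))
    term≡0 : gram l j * toℚ (v l c xor v j c) ≡ 0ℚ
    term≡0 = neg-injective (Σ-nonneg-0 (λ l → neg-antimono-≤ (signed-term≤0 j c l))
      (trans (Σ-neg (λ l → gram l j * toℚ (v l c xor v j c))) (cong -_ Σ≡0)) l)

  -- A 0/1 point is extreme in the cube: in each coordinate the weighted disagreements with `y` sum
  -- to zero, so every vertex of nonzero weight equals `y`. One exists because the weights sum to 1.
  convex⇒vertex : ∀ (y : Fin n → Bool) → (∀ j → 0ℚ ≤ β j (λ c → toℚ (y c))) →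
    ∃ λ j → β j (λ c → toℚ (y c)) ≢ 0ℚ × v j ≐ y
  convex⇒vertex y β≥0 = j , βj≢0 , same
    where
    b : Fin (suc n) → ℚ
    b j = β j (λ c → toℚ (y c))
    some = Σ-≢0 b (λ e → 1≢0 (trans (sym (Σβ (λ c → toℚ (y c)))) e))
    j = proj₁ some
    βj≢0 = proj₂ some
    Σ-diff : ∀ c → Σ[ (λ l → b l * toℚ (v l c xor y c)) ] ≡ 0ℚ
    Σ-diff c = begin
      Σ[ (λ l → b l * toℚ (v l c xor y c)) ]
        ≡⟨ Σ-cong (λ l → trans (cong (b l *_) (toℚ-xor (v l c) (y c)))
             (solve 4 (λ a e y z → a :* (e :* (y :- z)) := e :* (a :* y :- a :* z)) refl
               (b l) (η (y c)) (x l c) (toℚ (y c)))) ⟩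
      Σ[ (λ l → η (y c) * (b l * x l c - b l * toℚ (y c))) ]
        ≡⟨ Σ-*ˡ (η (y c)) (λ l → b l * x l c - b l * toℚ (y c)) ⟩
      η (y c) * Σ[ (λ l → b l * x l c - b l * toℚ (y c)) ]
        ≡⟨ cong (η (y c) *_) (Σ-- (λ l → b l * x l c) (λ l → b l * toℚ (y c))) ⟩
      η (y c) * (Σ[ (λ l → b l * x l c) ] - Σ[ (λ l → b l * toℚ (y c)) ])
        ≡⟨ cong (η (y c) *_) (cong₂ _-_ (Σβx (λ c → toℚ (y c)) c)
             (trans (Σ-*ʳ b (toℚ (y c))) (cong (_* toℚ (y c)) (Σβ (λ c → toℚ (y c)))))) ⟩
      η (y c) * (toℚ (y c) - 1ℚ * toℚ (y c))
        ≡⟨ solve 2 (λ e z → e :* (z :- con 1ℚ :* z) := con 0ℚ) refl (η (y c)) (toℚ (y c)) ⟩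
      0ℚ ∎
      where open ≡-Reasoning
    same : v j ≐ y
    same c = xor-≡ (toℚ-injective (p*q≡0 (b j) (toℚ (v j c xor y c))
      (Σ-nonneg-0 (λ l → *-nonneg (β≥0 l) (toℚ-nonneg (v l c xor y c))) (Σ-diff c) j) βj≢0))

-- Block triangular vertex matrices

δ-inj : ∀ {k n} (f : Fin k → Fin n) → (∀ {a b} → f a ≡ f b → a ≡ b) → ∀ a b → δ (f a) (f b) ≡ δ a b
δ-inj f inj a b with a ≟ b
... | yes refl = trans (δ-refl (f a)) (sym (δ-refl a))
... | no  ne   = trans (δ-≢ (λ e → ne (inj e))) (sym (δ-≢ ne))

-- Block indices are recorded as levels of coordinates and of vertices. The vertex `o` is the
-- origin; it lies strictly below all coordinate levels and so belongs to no block.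
module BlockTriangular {n q : ℕ} {v : Fin (suc n) → Fin n → Bool} (S : NonobtuseDual v)
  (o : Fin (suc n)) (o-zero : ∀ c → v o c ≡ false)
  (rlev : Fin n → Fin q) (vlev : Fin (suc n) → Fin q)
  (upper : ∀ j c → vlev j F.< rlev c → v j c ≡ false)
  (o-min : ∀ c → vlev o F.< rlev c)
  where

  open NonobtuseProperties S
  private x = embed v

  record Block (L : Fin q) : Set where
    field
      k       : ℕ
      row     : Fin k → Fin n
      row-inj : ∀ {a b} → row a ≡ row b → a ≡ b
      row-lev : ∀ a → rlev (row a) ≡ L
      row-sur : ∀ c → rlev c ≡ L → ∃ λ a → row a ≡ c
      col     : Fin k → Fin (suc n)
      col-inj : ∀ {a b} → col a ≡ col b → a ≡ b
      col-lev : ∀ b → vlev (col b) ≡ L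
      col-sur : ∀ j → vlev j ≡ L → ∃ λ b → col b ≡ j
      acute   : Acute (colSimplex (λ a b → v (col b) (row a)))

  infixl 8 _↾_
  _↾_ : (Fin n → ℚ) → Fin q → Fin n → ℚ
  (h ↾ L) c = δ L (rlev c) * h c

  ↾-on : ∀ h {L} c → rlev c ≡ L → (h ↾ L) c ≡ h c
  ↾-on h c refl = trans (cong (_* h c) (δ-refl (rlev c))) (*-identityˡ (h c))

  ↾-off : ∀ h {L} c → rlev c ≢ L → (h ↾ L) c ≡ 0ℚ
  ↾-off h c ne = trans (cong (_* h c) (δ-≢ (λ e → ne (sym e)))) (*-zeroˡ (h c))

  ↾-swap : ∀ h z L → dot (h ↾ L) z ≡ dot h (z ↾ L)
  ↾-swap h z L = Σ-cong (λ c →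
    solve 3 (λ d a b → d :* a :* b := a :* (d :* b)) refl (δ L (rlev c)) (h c) (z c))

  ↾-idem : ∀ h L c → (h ↾ L ↾ L) c ≡ (h ↾ L) c
  ↾-idem h L c with rlev c ≟ L
  ... | yes p = ↾-on (h ↾ L) c p
  ... | no  p = trans (↾-off (h ↾ L) c p) (sym (↾-off h c p))

  dot-↾-0ˡ : ∀ h z {L} → (∀ c → rlev c ≡ L → h c ≡ 0ℚ) → dot h (z ↾ L) ≡ 0ℚ
  dot-↾-0ˡ h z {L} p = Σ-zero term
    where
    term : ∀ c → h c * (z ↾ L) c ≡ 0ℚ
    term c with rlev c ≟ L
    ... | yes e = trans (cong (_* (z ↾ L) c) (p c e)) (*-zeroˡ ((z ↾ L) c))
    ... | no  e = trans (cong (h c *_) (↾-off z c e)) (*-zeroʳ (h c))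

  dot-↾-0ʳ : ∀ h z {L} → (∀ c → rlev c ≡ L → z c ≡ 0ℚ) → dot h (z ↾ L) ≡ 0ℚ
  dot-↾-0ʳ h z {L} p = trans (sym (↾-swap h z L)) (trans (dot-comm (h ↾ L) z) (dot-↾-0ˡ z h p))

  x-upper : ∀ j c → vlev j F.< rlev c → x j c ≡ 0ℚ
  x-upper j c p = cong toℚ (upper j c p)

  κ-0 : ∀ {j} → j ≢ o → κ j ≡ 0ℚ
  κ-0 {j} ne = begin
    κ j                   ≡⟨ sym (+-identityˡ (κ j)) ⟩
    0ℚ + κ j              ≡⟨ cong (_+ κ j) (sym (dot-0 {h = g j} (λ c → cong toℚ (o-zero c)))) ⟩
    dot (g j) (x o) + κ j ≡⟨ dual j o ⟩
    δ j o                 ≡⟨ δ-≢ ne ⟩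
    0ℚ                    ∎
    where open ≡-Reasoning

  dual′ : ∀ {j} → j ≢ o → ∀ l → dot (g j) (x l) ≡ δ j l
  dual′ {j} ne l = begin
    dot (g j) (x l)       ≡⟨ sym (+-identityʳ (dot (g j) (x l))) ⟩
    dot (g j) (x l) + 0ℚ  ≡⟨ cong (dot (g j) (x l) +_) (sym (κ-0 ne)) ⟩
    dot (g j) (x l) + κ j ≡⟨ dual j l ⟩
    δ j l                 ∎
    where open ≡-Reasoning

  module Triangular (blocks : ∀ c → Block (rlev c)) where

    -- Inductive step of the fact that inverting preserves block triangularity. A combination `y` of
    -- the columns of level `L` is chosen to equal the unit vector at `c` on that level. It vanishes
    -- above `L`, and `g l` vanishes below, so `g l c` equals `dot (g l) y`, which is zero by
    -- duality.
    gradient-upper-step : ∀ {L} → (∀ c → rlev c F.< L → ∀ l → rlev c F.< vlev l → g l c ≡ 0ℚ) →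
      ∀ c → rlev c ≡ L → ∀ l → L F.< vlev l → g l c ≡ 0ℚ
    gradient-upper-step {L} ih c refl l L<l = begin
      g l c
        ≡⟨ sym (Σ-δʳ c (g l)) ⟩
      Σ[ (λ d → g l d * δ d c) ]
        ≡⟨ Σ-cong agree ⟩
      dot (g l) y
        ≡⟨ dot-Σ (g l) α (λ b → x (col b)) ⟩
      Σ[ (λ b → α b * dot (g l) (x (col b))) ]
        ≡⟨ Σ-zero (λ b → trans (cong (α b *_) (trans (dual′ (l≢o) (col b)) (δ-≢ (l≢col b)))) (*-zeroʳ (α b))) ⟩
      0ℚ ∎
      where
      open ≡-Reasoning
      open Block (blocks c)
      o≢ : ∀ {j} → L F.≤ vlev j → j ≢ o
      o≢ p refl = ℕₚ.<-irrefl refl (ℕₚ.<-≤-trans (o-min c) p)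
      l≢o : l ≢ o
      l≢o = o≢ (ℕₚ.<⇒≤ L<l)
      l≢col : ∀ b → l ≢ col b
      l≢col b refl = ℕₚ.<-irrefl (cong toℕ (sym (col-lev b))) L<l
      u : Family k k
      u b a = x (col b) (row a)
      combination : (Fin k → ℚ) → Fin n → ℚ
      combination μ d = Σ[ (λ b → μ b * x (col b) d) ]
      combination-above : ∀ μ d → L F.< rlev d → combination μ d ≡ 0ℚ
      combination-above μ d p = Σ-zero (λ b → trans
        (cong (μ b *_) (x-upper (col b) d (subst (F._< rlev d) (sym (col-lev b)) p))) (*-zeroʳ (μ b)))
      -- Pairing with `g (col b)` extracts `μ b`, and this pairing sees only level `L`, where `rel`
      -- applies.
      independent : Independent u
      independent μ rel b = begin
        μ b
          ≡⟨ sym (Σ-δʳ b μ) ⟩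
        Σ[ (λ b′ → μ b′ * δ b′ b) ]
          ≡⟨ Σ-cong (λ b′ → cong (μ b′ *_) (sym (trans
               (dual′ (o≢ (ℕₚ.≤-reflexive (cong toℕ (sym (col-lev b))))) (col b′))
               (trans (δ-inj col col-inj b b′) (δ-sym b b′))))) ⟩
        Σ[ (λ b′ → μ b′ * dot (g (col b)) (x (col b′))) ]
          ≡⟨ sym (dot-Σ (g (col b)) μ (λ b → x (col b))) ⟩
        dot (g (col b)) (combination μ)
          ≡⟨ Σ-zero term ⟩
        0ℚ ∎
        where
        term : ∀ d → g (col b) d * combination μ d ≡ 0ℚ
        term d with Fₚ.<-cmp (rlev d) L
        ... | tri< p _ _ = trans
          (cong (_* combination μ d) (ih d p (col b) (subst (rlev d F.<_) (sym (col-lev b)) p)))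
          (*-zeroˡ (combination μ d))
        ... | tri> _ _ p = trans (cong (g (col b) d *_) (combination-above μ d p)) (*-zeroʳ (g (col b) d))
        ... | tri≈ _ p _ with row-sur d p
        ...   | a , refl = trans (cong (g (col b) d *_) (rel a)) (*-zeroʳ (g (col b) d))
      a₀ = proj₁ (row-sur c refl)
      row-a₀ : row a₀ ≡ c
      row-a₀ = proj₂ (row-sur c refl)
      abstract
        solution : ∃ λ (α : Fin k → ℚ) → ∀ a → Σ[ (λ b → α b * u b a) ] ≡ δ a₀ a
        solution = independent⇒spanning u independent a₀
      α : Fin k → ℚ
      α = proj₁ solution
      y = combination α
      agree : ∀ d → g l d * δ d c ≡ g l d * y d
      agree d with Fₚ.<-cmp (rlev d) L
      ... | tri< p _ _ = trans (cong (_* δ d c) z) (trans (*-zeroˡ (δ d c)) (sym (trans (cong (_* y d) z) (*-zeroˡ (y d)))))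
        where z = ih d p l (ℕₚ.<-trans p L<l)
      ... | tri> _ ne p = cong (g l d *_) (trans (δ-≢ (λ e → ne (cong rlev e))) (sym (combination-above α d p)))
      ... | tri≈ _ p _ with row-sur d p
      ...   | a , refl = cong (g l d *_) (trans (cong (δ (row a)) (sym row-a₀))
                           (trans (δ-inj row row-inj a a₀) (trans (δ-sym a a₀) (sym (proj₂ solution a)))))

    gradient-upper : ∀ l c → rlev c F.< vlev l → g l c ≡ 0ℚ
    gradient-upper l c p = go (rlev c) (FI.<-wellFounded (rlev c)) c refl l p
      where
      go : ∀ L → Acc F._<_ L → ∀ c → rlev c ≡ L → ∀ l → L F.< vlev l → g l c ≡ 0ℚ
      go L (acc rs) = gradient-upper-step (λ c p l q → go (rlev c) (rs p) c refl l q)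

    module AtBlock (c₀ : Fin n) where
      private L = rlev c₀
      open Block (blocks c₀)

      o-below : vlev o F.< L
      o-below = o-min c₀

      not-o : ∀ {j} → ¬ vlev j F.< L → j ≢ o
      not-o p refl = p o-below

      col-not-below : ∀ b → ¬ vlev (col b) F.< L
      col-not-below b p = ℕₚ.<-irrefl (cong toℕ (col-lev b)) p

      below≢col : ∀ {j} → vlev j F.< L → ∀ b → j ≢ col b
      below≢col p b refl = col-not-below b p

      x-below : ∀ {j} → vlev j F.< L → ∀ c → rlev c ≡ L → v j c ≡ false
      x-below {j} p c e = upper j c (subst (vlev j F.<_) (sym e) p)

      restrict : ∀ h z → dot (λ a → h (row a)) (λ a → z (row a)) ≡ dot h (z ↾ L)
      restrict h z = trans (Σ-image row rlev L row-inj row-lev row-sur (λ c → h c * z c)) (Σ-cong (λ c →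
        solve 3 (λ d a b → d :* (a :* b) := a :* (d :* b)) refl (δ L (rlev c)) (h c) (z c)))

      γ : Fin (suc n) → Fin k → ℚ
      γ j a = g j (row a)

      simplex : Family (suc k) k
      simplex = colSimplex (λ a b → v (col b) (row a))

      -- Below `L` the gradient vanishes and above `L` the column does, so the whole pairing sits in
      -- level `L`: the restricted gradients invert the diagonal block.
      dual-col : ∀ b b′ → dot (g (col b)) (x (col b′) ↾ L) ≡ δ b b′
      dual-col b b′ = trans (Σ-cong term)
        (trans (dual′ (not-o (col-not-below b)) (col b′)) (δ-inj col col-inj b b′))
        where
        term : ∀ c → g (col b) c * (x (col b′) ↾ L) c ≡ g (col b) c * x (col b′) c
        term c with Fₚ.<-cmp (rlev c) L
        ... | tri< p _ _ = trans (cong (_* (x (col b′) ↾ L) c) z)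
                (trans (*-zeroˡ ((x (col b′) ↾ L) c)) (sym (trans (cong (_* x (col b′) c) z) (*-zeroˡ (x (col b′) c)))))
          where z = gradient-upper (col b) c (subst (rlev c F.<_) (sym (col-lev b)) p)
        ... | tri≈ _ p _ = cong (g (col b) c *_) (↾-on (x (col b′)) c p)
        ... | tri> _ ne p = cong (g (col b) c *_) (trans (↾-off (x (col b′)) c ne)
                (sym (x-upper (col b′) c (subst (F._< rlev c) (sym (col-lev b′)) p))))

      normal-col : ∀ b → IsInwardNormal simplex (suc b) (γ (col b))
      normal-col b = dual⇒inwardNormal simplex (suc b) (γ (col b)) 0ℚ dual-simplex
        where
        dual-simplex : ∀ e → dot (γ (col b)) (simplex e) + 0ℚ ≡ δ (suc b) e
        dual-simplex zero     = trans (+-identityʳ (dot (γ (col b)) (simplex zero)))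
          (dot-0 {h = γ (col b)} {simplex zero} (λ _ → refl))
        dual-simplex (suc b′) = trans (+-identityʳ (dot (γ (col b)) (simplex (suc b′))))
          (trans (restrict (g (col b)) (x (col b′))) (dual-col b b′))

      acute-col : ∀ b b′ → b ≢ b′ → dot (g (col b)) (g (col b′) ↾ L) < 0ℚ
      acute-col b b′ ne = subst (_< 0ℚ) (restrict (g (col b)) (g (col b′)))
        (acute (suc b) (suc b′) (λ e → ne (Fₚ.suc-injective e)) (γ (col b)) (γ (col b′)) (normal-col b) (normal-col b′))

      -- The part of the column lying above its diagonal block in the matrix.
      trunc : Fin k → Fin n → Bool
      trunc b d with rlev d Fₚ.<? L
      ... | yes _ = v (col b) d
      ... | no  _ = false

      truncℚ : Fin k → Fin n → ℚ
      truncℚ b d = toℚ (trunc b d)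

      col-split : ∀ b d → x (col b) d ≡ truncℚ b d + (x (col b) ↾ L) d
      col-split b d with rlev d Fₚ.<? L
      ... | yes p = sym (trans (cong (x (col b) d +_) (↾-off (x (col b)) d (λ e → ℕₚ.<-irrefl (cong toℕ e) p)))
                          (+-identityʳ (x (col b) d)))
      ... | no  p with rlev d ≟ L
      ...   | yes e = sym (trans (+-identityˡ ((x (col b) ↾ L) d)) (↾-on (x (col b)) d e))
      ...   | no ne = trans (x-upper (col b) d (subst (F._< rlev d) (sym (col-lev b)) L<d))
                        (sym (trans (+-identityˡ ((x (col b) ↾ L) d)) (↾-off (x (col b)) d ne)))
        where
        L<d : L F.< rlev d
        L<d = Fₚ.≤∧≢⇒< (ℕₚ.≮⇒≥ p) (λ e → ne (sym e))

      dot-col-split : ∀ h b → dot h (x (col b)) ≡ dot h (truncℚ b) + dot h (x (col b) ↾ L)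
      dot-col-split h b = trans (Σ-cong (λ d → trans (cong (h d *_) (col-split b d))
        (*-distribˡ-+ (h d) (truncℚ b d) ((x (col b) ↾ L) d))))
        (Σ-+ (λ d → h d * truncℚ b d) (λ d → h d * (x (col b) ↾ L) d))

      β-trunc-below : ∀ {j} → vlev j F.< L → ∀ b → β j (truncℚ b) ≡ - dot (g j) (x (col b) ↾ L)
      β-trunc-below {j} p b = begin
        dot (g j) (truncℚ b) + κ j
          ≡⟨ solve 3 (λ t m k → t :+ k := ((t :+ m) :+ k) :- m) refl (dot (g j) (truncℚ b)) m (κ j) ⟩
        dot (g j) (truncℚ b) + m + κ j - m
          ≡⟨ cong (λ z → z + κ j - m) (sym (dot-col-split (g j) b)) ⟩
        dot (g j) (x (col b)) + κ j - m
          ≡⟨ cong (_- m) (trans (dual j (col b)) (δ-≢ (below≢col p b))) ⟩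
        0ℚ - m
          ≡⟨ +-identityˡ (- m) ⟩
        - m ∎
        where
        open ≡-Reasoning
        m = dot (g j) (x (col b) ↾ L)

      β-trunc-above : ∀ {j} → ¬ vlev j F.< L → ∀ b → β j (truncℚ b) ≡ 0ℚ
      β-trunc-above {j} p b = cong₂ _+_ (Σ-zero term) (κ-0 (not-o p))
        where
        term : ∀ d → g j d * truncℚ b d ≡ 0ℚ
        term d with rlev d Fₚ.<? L
        ... | yes q = trans (cong (_* x (col b) d) (gradient-upper j d (ℕₚ.<-≤-trans q (ℕₚ.≮⇒≥ p))))
                        (*-zeroˡ (x (col b) d))
        ... | no  q = *-zeroʳ (g j d)

      -- A vertex of level below `L` has only zero bits in level `L`, so its gradient is nonpositive
      -- there, while the column is nonnegative. All other vertices have weight zero.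
      β-trunc-nonneg : ∀ b j → 0ℚ ≤ β j (truncℚ b)
      β-trunc-nonneg b j with vlev j Fₚ.<? L
      ... | no  p = ≤-reflexive (sym (β-trunc-above p b))
      ... | yes p = subst (0ℚ ≤_) (sym (β-trunc-below p b)) (neg-antimono-≤ (Σ-nonpos term))
        where
        term : ∀ c → g j c * (x (col b) ↾ L) c ≤ 0ℚ
        term c with rlev c ≟ L
        ... | yes e = subst (λ z → g j c * z ≤ 0ℚ) (sym (↾-on (x (col b)) c e))
                        (*-nonpos-nonneg (gradient≤0 j c (x-below p c e)) (toℚ-nonneg (v (col b) c)))
        ... | no ne = ≤-reflexive (trans (cong (g j c *_) (↾-off (x (col b)) c ne)) (*-zeroʳ (g j c)))

      abstract
        trunc-vertex : ∀ b → ∃ λ j → β j (truncℚ b) ≢ 0ℚ × v j ≐ trunc b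
        trunc-vertex b = convex⇒vertex (trunc b) (β-trunc-nonneg b)

      base : Fin k → Fin (suc n)
      base b = proj₁ (trunc-vertex b)

      base-trunc : ∀ b → v (base b) ≐ trunc b
      base-trunc b = proj₂ (proj₂ (trunc-vertex b))

      base-below : ∀ b → vlev (base b) F.< L
      base-below b with vlev (base b) Fₚ.<? L
      ... | yes p = p
      ... | no  p = ⊥-elim (proj₁ (proj₂ (trunc-vertex b)) (β-trunc-above p b))

      dual-base : ∀ {j} → vlev j F.< L → ∀ b → dot (g j) (x (col b) ↾ L) ≡ - δ j (base b)
      dual-base {j} p b = neg-injective (begin
        - dot (g j) (x (col b) ↾ L)   ≡⟨ sym (β-trunc-below p b) ⟩
        β j (truncℚ b)                ≡⟨ cong (_+ κ j) (dot-congʳ {h = g j} (λ c → cong toℚ (sym (base-trunc b c)))) ⟩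
        β j (x (base b))              ≡⟨ dual j (base b) ⟩
        δ j (base b)                  ≡⟨ solve 1 (λ a → a := :- (:- a)) refl (δ j (base b)) ⟩
        - (- δ j (base b))            ∎)
        where open ≡-Reasoning

      -- Above level L both gradients are nonpositive, so restricting to level L only drops nonnegative terms.
      below-col≤0 : ∀ {j} → vlev j F.< L → ∀ b → dot (g j) (g (col b) ↾ L) ≤ 0ℚ
      below-col≤0 {j} p b = ≤-trans (Σ-mono term) (gram≤0 j (col b) (below≢col p b))
        where
        term : ∀ c → g j c * (g (col b) ↾ L) c ≤ g j c * g (col b) c
        term c with Fₚ.<-cmp (rlev c) L
        ... | tri≈ _ e _ = ≤-reflexive (cong (g j c *_) (↾-on (g (col b)) c e))
        ... | tri< q ne _ = ≤-reflexive (cong (g j c *_) (trans (↾-off (g (col b)) c ne)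
                (sym (gradient-upper (col b) c (subst (rlev c F.<_) (sym (col-lev b)) q)))))
        ... | tri> _ ne q = ≤-trans
                (≤-reflexive (trans (cong (g j c *_) (↾-off (g (col b)) c ne)) (*-zeroʳ (g j c))))
                (*-nonpos² (gradient≤0 j c (upper j c (ℕₚ.<-trans p q)))
                           (gradient≤0 (col b) c (upper (col b) c (subst (F._< rlev c) (sym (col-lev b)) q))))

      -- If the two bases differed, pair the restrictions to `L` of the gradients of `base b₀` and
      -- `col b₁`. Expanding over the vertices, acuteness makes the value positive, against
      -- `below-col≤0`.
      base-constant : ∀ b₀ b₁ → base b₀ ≡ base b₁
      base-constant b₀ b₁ with base b₀ ≟ base b₁
      ... | yes e = e
      ... | no ne = ⊥-elim (<-irrefl refl (<-≤-trans hz>0 hz≤0))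
        where
        j = base b₀
        h z : Fin n → ℚ
        h = g j ↾ L
        z = g (col b₁) ↾ L
        b₀≢b₁ : b₀ ≢ b₁
        b₀≢b₁ e = ne (cong base e)
        h-col : ∀ b → dot h (x (col b)) ≡ - δ j (base b)
        h-col b = trans (↾-swap (g j) (x (col b)) L) (dual-base (base-below b₀) b)
        hz≤0 : dot h z ≤ 0ℚ
        hz≤0 = subst (_≤ 0ℚ) (sym (trans (↾-swap (g j) z L) (dot-congʳ {h = g j} (↾-idem (g (col b₁)) L))))
          (below-col≤0 (base-below b₀) b₁)
        -δ≤0 : ∀ b → - δ j (base b) ≤ 0ℚ
        -δ≤0 b with j ≟ base b
        ... | yes e = subst (λ t → - t ≤ 0ℚ) (sym (δ-≡ e)) (neg-antimono-≤ 0≤1)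
        ... | no  e = ≤-reflexive (cong -_ (δ-≢ e))
        -- Only columns of the block contribute, since lower vertices and the gradients of higher
        -- ones vanish on `L`. The term of `b₁` itself, not covered by acuteness, has a zero factor
        -- because the bases differ.
        term : ∀ l → 0ℚ ≤ dot h (x l) * dot (g l) z
        term l with Fₚ.<-cmp (vlev l) L
        ... | tri< p _ _ = ≤-reflexive (sym (trans (cong (_* dot (g l) z)
                (trans (↾-swap (g j) (x l) L) (dot-↾-0ʳ (g j) (x l) (λ c e → cong toℚ (x-below p c e)))))
                (*-zeroˡ (dot (g l) z))))
        ... | tri> _ _ p = ≤-reflexive (sym (trans (cong (dot h (x l) *_)
                (dot-↾-0ˡ (g l) (g (col b₁)) (λ c e → gradient-upper l c (subst (F._< vlev l) (sym e) p))))
                (*-zeroʳ (dot h (x l)))))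
        ... | tri≈ _ p _ with col-sur l p
        ...   | b , refl with b ≟ b₁
        ...     | yes refl = ≤-reflexive (sym (trans (cong (_* dot (g l) z) (trans (h-col b) (cong -_ (δ-≢ ne))))
                               (*-zeroˡ (dot (g l) z))))
        ...     | no  b≢b₁ = *-nonpos² (subst (_≤ 0ℚ) (sym (h-col b)) (-δ≤0 b)) (<⇒≤ (acute-col b b₁ b≢b₁))
        hz>0 : 0ℚ < dot h z
        -- Strictness comes from `col b₀`, whose first factor is - 1.
        hz>0 = subst (0ℚ <_) (expand-dot h z) (Σ-pos term (col b₀) (*-neg²
          (subst (_< 0ℚ) (sym (trans (h-col b₀) (cong -_ (δ-refl j)))) (neg-antimono-< 0<1))
          (acute-col b₀ b₁ b₀≢b₁)))

      private
        -- By `base-constant` any index yields the same root; the position of the row `c₀` shows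
        -- that the block is nonempty.
        b₀ : Fin k
        b₀ = proj₁ (row-sur c₀ refl)

      root : Fin (suc n)
      root = base b₀

      -- The truncated column is the vertex `root`, so what remains on level `L` is the difference
      -- of the vertices `col b` and `root`.
      dual-block : ∀ l b → dot (g l) (x (col b) ↾ L) ≡ δ l (col b) - δ l root
      dual-block l b = begin
        m
          ≡⟨ solve 3 (λ t m k → m := ((t :+ m) :+ k) :- (t :+ k)) refl t m (κ l) ⟩
        t + m + κ l - (t + κ l)
          ≡⟨ cong₂ (λ p q → p + κ l - (q + κ l)) (sym (dot-col-split (g l) b))
               (dot-congʳ {h = g l} (λ c → cong toℚ (sym (base-trunc b c)))) ⟩
        β l (x (col b)) - β l (x (base b))
          ≡⟨ cong₂ _-_ (dual l (col b)) (trans (dual l (base b)) (cong (δ l) (base-constant b b₀))) ⟩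
        δ l (col b) - δ l root ∎
        where
        open ≡-Reasoning
        m = dot (g l) (x (col b) ↾ L)
        t = dot (g l) (truncℚ b)

      -- Expand the restricted gradient over the vertices: lower vertices pair to zero with it,
      -- higher ones have zero gradient on `L`, and the columns of the block pair to zero by
      -- `dual-block`.
      outside : ∀ l → l ≢ root → vlev l ≢ L → ∀ c → rlev c ≡ L → g l c ≡ 0ℚ
      outside l l≢root l∉ c e = begin
        g l c
          ≡⟨ sym (↾-on (g l) c e) ⟩
        (g l ↾ L) c
          ≡⟨ sym (expandˡ (g l ↾ L) c) ⟩
        Σ[ (λ j → dot (g l ↾ L) (x j) * g j c) ]
          ≡⟨ Σ-zero term ⟩
        0ℚ ∎
        where
        open ≡-Reasoning
        zeroˡ : ∀ j → dot (g l ↾ L) (x j) ≡ 0ℚ → dot (g l ↾ L) (x j) * g j c ≡ 0ℚ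
        zeroˡ j p = trans (cong (_* g j c) p) (*-zeroˡ (g j c))
        term : ∀ j → dot (g l ↾ L) (x j) * g j c ≡ 0ℚ
        term j with Fₚ.<-cmp (vlev j) L
        ... | tri< p _ _ = zeroˡ j (trans (↾-swap (g l) (x j) L)
                (dot-↾-0ʳ (g l) (x j) (λ c e → cong toℚ (x-below p c e))))
        ... | tri> _ _ p = trans (cong (dot (g l ↾ L) (x j) *_)
                (gradient-upper j c (subst (F._< vlev j) (sym e) p))) (*-zeroʳ (dot (g l ↾ L) (x j)))
        ... | tri≈ _ p _ with col-sur j p
        ...   | b , refl = zeroˡ (col b) (trans (↾-swap (g l) (x (col b)) L) (trans (dual-block l b)
                (cong₂ _-_ (δ-≢ (λ l≡ → l∉ (trans (cong vlev l≡) (col-lev b)))) (δ-≢ l≢root))))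

      vertex : Fin (suc k) → Fin (suc n)
      vertex zero    = root
      vertex (suc b) = col b

      normal-vertex : ∀ e → IsInwardNormal simplex e (γ (vertex e))
      normal-vertex (suc b) = normal-col b
      -- The constant term is 1 because the restricted gradient of `root` takes the value 0 at the
      -- origin of the component and - 1 at each column.
      normal-vertex zero    = dual⇒inwardNormal simplex zero (γ root) 1ℚ dual-simplex
        where
        dual-simplex : ∀ e → dot (γ root) (simplex e) + 1ℚ ≡ δ zero e
        dual-simplex zero    = cong (_+ 1ℚ) (dot-0 {h = γ root} {simplex zero} (λ _ → refl))
        dual-simplex (suc b) = cong (_+ 1ℚ) (trans (restrict (g root) (x (col b))) (trans (dual-block root b)
          (cong₂ _-_ (δ-≢ (below≢col (base-below b₀) b)) (δ-refl root))))

      inside : ∀ e e′ → e ≢ e′ → dot (g (vertex e)) (g (vertex e′) ↾ L) < 0ℚ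
      inside e e′ ne = subst (_< 0ℚ) (restrict (g (vertex e)) (g (vertex e′)))
        (acute e e′ ne (γ (vertex e)) (γ (vertex e′)) (normal-vertex e) (normal-vertex e′))

      vertex? : ∀ l → (∃ λ e → vertex e ≡ l) ⊎ (∀ c → rlev c ≡ L → g l c ≡ 0ℚ)
      vertex? l with l ≟ root | vlev l ≟ L
      ... | yes p | _     = inj₁ (zero , sym p)
      ... | no  p | yes q = inj₁ (suc (proj₁ (col-sur l q)) , proj₂ (col-sur l q))
      ... | no  p | no  q = inj₂ (outside l p q)

      vertices≠ : ∀ {e e′ l i} → vertex e ≡ l → vertex e′ ≡ i → l ≢ i → dot (g l) (g i ↾ L) < 0ℚ
      vertices≠ {e} {e′} refl refl ne = inside e e′ (λ p → ne (cong vertex p))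

      level≤0 : ∀ l i → l ≢ i → dot (g l) (g i ↾ L) ≤ 0ℚ
      level≤0 l i ne with vertex? l | vertex? i
      ... | inj₁ (e , p) | inj₁ (e′ , q) = <⇒≤ (vertices≠ {e} {e′} p q ne)
      ... | inj₂ p       | _             = ≤-reflexive (dot-↾-0ˡ (g l) (g i) p)
      ... | inj₁ _       | inj₂ q        = ≤-reflexive (dot-↾-0ʳ (g l) (g i) q)

      level<0 : ∀ l i → l ≢ i → g l c₀ ≢ 0ℚ → g i c₀ ≢ 0ℚ → dot (g l) (g i ↾ L) < 0ℚ
      level<0 l i ne l≢0 i≢0 with vertex? l | vertex? i
      ... | inj₁ (e , p) | inj₁ (e′ , q) = vertices≠ {e} {e′} p q ne
      ... | inj₂ p       | _             = ⊥-elim (l≢0 (p c₀ refl))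
      ... | inj₁ _       | inj₂ q        = ⊥-elim (i≢0 (q c₀ refl))

    dot-levels : ∀ h z → dot h z ≡ Σ[ (λ L → dot h (z ↾ L)) ]
    dot-levels h z = begin
      Σ[ (λ c → h c * z c) ]
        ≡⟨ Σ-cong (λ c → sym (trans (Σ-cong (λ L → solve 3 (λ d a b → a :* (d :* b) := a :* b :* d) refl
             (δ L (rlev c)) (h c) (z c))) (Σ-δʳ (rlev c) (λ _ → h c * z c)))) ⟩
      Σ[ (λ c → Σ[ (λ L → h c * (z ↾ L) c) ]) ]
        ≡⟨ Σ-swap (λ c L → h c * (z ↾ L) c) ⟩
      Σ[ (λ L → dot h (z ↾ L)) ] ∎
      where open ≡-Reasoning

    -- The inner product splits into nonpositive contributions of the levels, strictly negative at
    -- the level of the shared coordinate `c`.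
    gram<0 : ∀ l i → l ≢ i → ∀ c → g l c ≢ 0ℚ → g i c ≢ 0ℚ → gram l i < 0ℚ
    gram<0 l i ne c l≢0 i≢0 = subst (_< 0ℚ) (sym (dot-levels (g l) (g i)))
      (Σ-neg< level (rlev c) (AtBlock.level<0 c l i ne l≢0 i≢0))
      where
      level : ∀ L → dot (g l) (g i ↾ L) ≤ 0ℚ
      level L with any? (λ c → rlev c ≟ L)
      ... | yes (c , refl) = AtBlock.level≤0 c l i ne
      ... | no  empty      = ≤-reflexive (dot-↾-0ˡ (g l) (g i) (λ c e → ⊥-elim (empty (c , e))))

-- Reflecting a vertex to the origin

reflect : ∀ {n} → (Fin (suc n) → Fin n → Bool) → Fin (suc n) → Fin (suc n) → Fin n → Bool
reflect v o j c = v j c xor v o c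

reflect-dot : ∀ {n} (b : Fin n → Bool) (x y : Fin n → ℚ) →
  dot (λ c → η (b c) * x c) (λ c → η (b c) * y c) ≡ dot x y
reflect-dot b x y = Σ-cong (λ c → begin
  η (b c) * x c * (η (b c) * y c)
    ≡⟨ solve 3 (λ e p q → e :* p :* (e :* q) := e :* e :* (p :* q)) refl (η (b c)) (x c) (y c) ⟩
  η (b c) * η (b c) * (x c * y c)
    ≡⟨ cong (_* (x c * y c)) (η² (b c)) ⟩
  1ℚ * (x c * y c)
    ≡⟨ *-identityˡ (x c * y c) ⟩
  x c * y c ∎)
  where open ≡-Reasoning

-- Reflection flips the signs of the gradient entries where `v o` is true, which preserves inner
-- products. The constant terms are the barycentric coordinates of the origin, now the vertex `o`.
reflectDual : ∀ {n} {v : Fin (suc n) → Fin n → Bool} → NonobtuseDual v →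
  (o : Fin (suc n)) → NonobtuseDual (reflect v o)
reflectDual {n} {v} S o = record
  { dualBasis = record
    { g    = g′
    ; κ    = λ j → δ j o
    ; dual = dual″
    ; Σg   = λ c → trans (Σ-*ˡ (s c) (λ j → g j c)) (trans (cong (s c *_) (Σg c)) (*-zeroʳ (s c)))
    ; Σgx  = Σg′x′
    ; Σκ   = trans (Σ-cong (λ j → sym (*-identityˡ (δ j o)))) (Σ-δʳ o (λ _ → 1ℚ))
    ; Σκx  = λ c → trans (Σ-cong (λ j → *-comm (δ j o) (x′ j c)))
                     (trans (Σ-δʳ o (λ j → x′ j c)) (cong toℚ (xor-self (v o c))))
    }
  ; gram≤0 = λ j l ne → subst (_≤ 0ℚ) (sym (reflect-dot (v o) (g j) (g l))) (gram≤0 j l ne)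
  }
  where
  open NonobtuseDual S
  open ≡-Reasoning
  x x′ g′ : Family (suc n) n
  x  = embed v
  x′ = embed (reflect v o)
  s : Fin n → ℚ
  s c = η (v o c)
  g′ j c = s c * g j c
  dual″ : ∀ j k → dot (g′ j) (x′ k) + δ j o ≡ δ j k
  dual″ j k = begin
    dot (g′ j) (x′ k) + δ j o
      ≡⟨ cong (_+ δ j o) (trans (dot-congʳ {h = g′ j} (λ c → toℚ-xor (v k c) (v o c)))
           (reflect-dot (v o) (g j) (x k ⊖ x o))) ⟩
    dot (g j) (x k ⊖ x o) + δ j o
      ≡⟨ cong (_+ δ j o) (dual-⊖ j k o) ⟩
    δ j k - δ j o + δ j o
      ≡⟨ solve 2 (λ a b → a :- b :+ b := a) refl (δ j k) (δ j o) ⟩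
    δ j k ∎
  Σg′x′ : ∀ c d → Σ[ (λ j → g′ j c * x′ j d) ] ≡ δ c d
  Σg′x′ c d = begin
    Σ[ (λ j → g′ j c * x′ j d) ]
      ≡⟨ Σ-cong (λ j → trans (cong (g′ j c *_) (toℚ-xor (v j d) (v o d)))
           (solve 5 (λ e f a y z → e :* a :* (f :* (y :- z)) := e :* f :* (a :* y :- a :* z)) refl
             (s c) (s d) (g j c) (x j d) (x o d))) ⟩
    Σ[ (λ j → s c * s d * (g j c * x j d - g j c * x o d)) ]
      ≡⟨ Σ-*ˡ (s c * s d) (λ j → g j c * x j d - g j c * x o d) ⟩
    s c * s d * Σ[ (λ j → g j c * x j d - g j c * x o d) ]
      ≡⟨ cong (s c * s d *_) (trans (Σ-- (λ j → g j c * x j d) (λ j → g j c * x o d))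
           (cong₂ _-_ (Σgx c d) (trans (Σ-*ʳ (λ j → g j c) (x o d)) (cong (_* x o d) (Σg c))))) ⟩
    s c * s d * (δ c d - 0ℚ * x o d)
      ≡⟨ solve 3 (λ e a b → e :* (a :- con 0ℚ :* b) := e :* a) refl (s c * s d) (δ c d) (x o d) ⟩
    s c * s d * δ c d
      ≡⟨ diagonal ⟩
    δ c d ∎
    where
    diagonal : s c * s d * δ c d ≡ δ c d
    diagonal with c ≟ d
    ... | yes refl = trans (cong (_* δ c c) (η² (v o c))) (*-identityˡ (δ c c))
    ... | no  ne   = trans (cong (s c * s d *_) (δ-≢ ne)) (trans (*-zeroʳ (s c * s d)) (sym (δ-≢ ne)))

-- Supports of gradients in a simplex with acute components

module Components {n : ℕ} {v : Fin (suc n) → Fin n → Bool} (S : NonobtuseDual v)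
  (o : Fin (suc n)) (components : ∃ λ π → ∃ λ σ → AcuteBlockForm n (matRep v o π σ)) where

  private
    π = proj₁ components
    σ = proj₁ (proj₂ components)
  open AcuteBlockForm (proj₂ (proj₂ components))

  Position : Set
  Position = Σ (Fin p) (λ i → Fin (k i))

  private
    module Row = Inverse (π ↔-∘ rowPos)
    module Col = Inverse (σ ↔-∘ colPos)

  colVertex : Position → Fin (suc n)
  colVertex s = punchIn o (Col.to s)

  -- Block `i` becomes level `suc i`; level zero is reserved for `o`, which is not a column of the
  -- matrix representation.
  rlev : Fin n → Fin (suc p)
  rlev c = suc (proj₁ (Row.from c))

  vlev : Fin (suc n) → Fin (suc p)
  vlev j with o ≟ j
  ... | yes _ = zero
  ... | no ne = suc (proj₁ (Col.from (punchOut ne)))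

  vlev-o : vlev o ≡ zero
  vlev-o with o ≟ o
  ... | yes _ = refl
  ... | no ne = ⊥-elim (ne refl)

  vlev-col : ∀ s → vlev (colVertex s) ≡ suc (proj₁ s)
  vlev-col s with o ≟ colVertex s
  ... | yes e = ⊥-elim (punchInᵢ≢i o (Col.to s) (sym e))
  ... | no ne = cong (λ z → suc (proj₁ z)) (trans
    (cong Col.from (punchIn-injective o _ _ (punchIn-punchOut ne))) (Col.strictlyInverseʳ s))

  vlev-suc : ∀ j {i} → vlev j ≡ suc i → ∃ λ s → proj₁ s ≡ i × colVertex s ≡ j
  vlev-suc j e with o ≟ j
  vlev-suc j () | yes _
  ... | no ne = Col.from (punchOut ne) , Fₚ.suc-injective e ,
    trans (cong (punchIn o) (Col.strictlyInverseˡ (punchOut ne))) (punchIn-punchOut ne)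

  X : Fin (suc n) → Fin n → Bool
  X = reflect v o

  upper-position : ∀ s t → proj₁ s F.< proj₁ t → X (colVertex s) (Row.to t) ≡ false
  upper-position (j , b) (i , a) = upper i j a b

  upper-level : ∀ j c → vlev j F.< rlev c → X j c ≡ false
  upper-level j c lt with vlev j in e
  upper-level j c lt | zero with o ≟ j
  ... | yes refl = xor-self (v j c)
  upper-level j c lt | zero | no _ with () ← e
  upper-level j c lt | suc i with vlev-suc j e
  ... | s , refl , refl = subst (λ d → X (colVertex s) d ≡ false) (Row.strictlyInverseˡ c)
    (upper-position s (Row.from c) (s<s⁻¹ lt))

  o-min : ∀ c → vlev o F.< rlev c
  o-min c = subst (F._< rlev c) (sym vlev-o) ℕₚ.0<1+n

  open BlockTriangular (reflectDual S o) o (λ c → xor-self (v o c)) rlev vlev upper-level o-min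

  ,-injective : ∀ {i} {a b : Fin (k i)} → _≡_ {A = Position} (i , a) (i , b) → a ≡ b
  ,-injective refl = refl

  at-block : ∀ {A : Set} (f : Position → A) {i c} s → proj₁ s ≡ i → f s ≡ c → ∃ λ a → f (i , a) ≡ c
  at-block f (i , a) refl e = a , e

  blockAt : ∀ i → Block (suc i)
  blockAt i = record
    { k       = k i
    ; row     = λ a → Row.to (i , a)
    ; row-inj = λ e → ,-injective (to-injective Row.from Row.strictlyInverseʳ e)
    ; row-lev = λ a → cong (λ s → suc (proj₁ s)) (Row.strictlyInverseʳ (i , a))
    ; row-sur = λ c e → at-block Row.to (Row.from c) (Fₚ.suc-injective e) (Row.strictlyInverseˡ c)
    ; col     = λ b → colVertex (i , b)
    ; col-inj = λ e → ,-injective (to-injective Col.from Col.strictlyInverseʳ (punchIn-injective o _ _ e))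
    ; col-lev = λ b → vlev-col (i , b)
    ; col-sur = λ j e → let (s , p , q) = vlev-suc j e in at-block colVertex s p q
    ; acute   = acute i
    }
    where
    to-injective : ∀ {f : Position → Fin n} (h : Fin n → Position) → (∀ s → h (f s) ≡ s) →
      ∀ {s t} → f s ≡ f t → s ≡ t
    to-injective h inv {s} {t} e = trans (sym (inv s)) (trans (cong h e) (inv t))

  open NonobtuseDual S

  -- Reflection preserves supports and inner products, so `gram<0` carries back to `v`.
  common-support⇒gram<0 : ∀ l i → l ≢ i → ∀ c → g l c ≢ 0ℚ → g i c ≢ 0ℚ → gram l i < 0ℚ
  common-support⇒gram<0 l i ne c l≢0 i≢0 = subst (_< 0ℚ) (reflect-dot (v o) (g l) (g i))
    (Triangular.gram<0 (λ c → blockAt (proj₁ (Row.from c))) l i ne c (nonzero l≢0) (nonzero i≢0))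
    where
    nonzero : ∀ {j} → g j c ≢ 0ℚ → η (v o c) * g j c ≢ 0ℚ
    nonzero {j} p e = p (p*q≡0 (η (v o c)) (g j c) e (η≢0 (v o c)))

-- Neighbours across a facet

replace-at : ∀ {n} (v : Fin (suc n) → Fin n → Bool) i w → replace v i w i ≡ w
replace-at v i w with i ≟ i
... | yes _ = refl
... | no ne = ⊥-elim (ne refl)

replace-off : ∀ {n} (v : Fin (suc n) → Fin n → Bool) i w j → j ≢ i → replace v i w j ≡ v j
replace-off v i w j ne with j ≟ i
... | yes e = ⊥-elim (ne e)
... | no  _ = refl

Σ-single : ∀ {n} (f : Fin n → ℚ) l → (∀ j → j ≢ l → f j ≡ 0ℚ) → Σ[ f ] ≡ f l
Σ-single f l p = trans (Σ-cong term) (Σ-δ l f)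
  where
  term : ∀ j → f j ≡ δ l j * f j
  term j with j ≟ l
  ... | yes refl = sym (trans (cong (_* f j) (δ-refl j)) (*-identityˡ (f j)))
  ... | no  ne   = trans (p j ne) (sym (trans (cong (δ l j *_) (p j ne)) (*-zeroʳ (δ l j))))

-- A zero gradient would make the barycentric coordinate constant, yet it is 1 at vertex `j` and 0
-- at another vertex, which is named with the help of `d`.
gradient-nonzero : ∀ {n} {x : Family (suc n) n} (D : Dual x) → Fin n → ∀ j → ∃ λ c → Dual.g D j c ≢ 0ℚ
gradient-nonzero {x = x} D d j with any? (λ c → ¬? (Dual.g D j c ℚ.≟ 0ℚ))
... | yes p = p
... | no  p = ⊥-elim (1≢0 (begin
  1ℚ                    ≡⟨ sym (δ-refl j) ⟩
  δ j j                 ≡⟨ sym (dual j j) ⟩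
  dot (g j) (x j) + κ j ≡⟨ cong (_+ κ j) (trans (vanish j) (sym (vanish k))) ⟩
  dot (g j) (x k) + κ j ≡⟨ dual j k ⟩
  δ j k                 ≡⟨ δ-≢ (λ e → punchInᵢ≢i j d (sym e)) ⟩
  0ℚ                    ∎))
  where
  open Dual D
  open ≡-Reasoning
  k = punchIn j d
  vanish : ∀ l → dot (g j) (x l) ≡ 0ℚ
  vanish l = Σ-zero (λ c → trans
    (cong (_* x l c) (decidable-stable (g j c ℚ.≟ 0ℚ) (λ ne → p (c , ne)))) (*-zeroˡ (x l c)))

*-pos-neg : ∀ {p q} → 0ℚ < p → q < 0ℚ → p * q < 0ℚ
*-pos-neg {p} {q} a b = negative⁻¹ (p * q) {{pos*neg⇒neg p {{positive a}} q {{negative b}}}}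

not-≡ : ∀ {a b} → a ≢ b → a ≡ not b
not-≡ {true}  {true}  p = ⊥-elim (p refl)
not-≡ {true}  {false} p = refl
not-≡ {false} {true}  p = refl
not-≡ {false} {false} p = ⊥-elim (p refl)

not-xor : ∀ b → not b xor b ≡ true
not-xor true  = refl
not-xor false = refl

η-not : ∀ b → η (not b) ≡ - η b
η-not true  = refl
η-not false = refl

toℚ-not : ∀ b → toℚ (not b) - toℚ b ≡ η b
toℚ-not true  = refl
toℚ-not false = refl

signed<0 : ∀ b {q} → η b * q ≤ 0ℚ → q ≢ 0ℚ → η b * q < 0ℚ
signed<0 b {q} p ne = ≤∧≢⇒< p (λ e → ne (p*q≡0 (η b) q e (η≢0 b)))

-- Under the sign rule a nonzero gradient entry determines the bit. A positive factor `s` keeps that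
-- bit; a negative one, in `opposite-sign`, flips it.
same-sign : ∀ a b {s q} → 0ℚ < s → q ≢ 0ℚ → η a * q ≤ 0ℚ → η b * (s * q) ≤ 0ℚ → b ≡ a
same-sign a b {s} {q} 0<s q≢0 A B with b Bool.≟ a
... | yes e = e
... | no ne = ⊥-elim (<-irrefl refl (<-≤-trans (*-pos-neg 0<s (signed<0 a A q≢0)) (subst (0ℚ ≤_) eq (neg-antimono-≤ B))))
  where
  eq : - (η b * (s * q)) ≡ s * (η a * q)
  eq = trans (cong (λ z → - (z * (s * q))) (trans (cong η (not-≡ ne)) (η-not a)))
    (solve 3 (λ e s q → :- ((:- e) :* (s :* q)) := s :* (e :* q)) refl (η a) s q)

opposite-sign : ∀ a b {s q} → s < 0ℚ → q ≢ 0ℚ → η a * q ≤ 0ℚ → η b * (s * q) ≤ 0ℚ → b ≡ not a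
opposite-sign a b {s} {q} s<0 q≢0 A B with b Bool.≟ a
... | no ne = not-≡ ne
... | yes refl = ⊥-elim (<-irrefl refl (<-≤-trans (*-neg² s<0 (signed<0 a A q≢0)) (subst (_≤ 0ℚ) eq B)))
  where
  eq : η a * (s * q) ≡ s * (η a * q)
  eq = solve 3 (λ e s q → e :* (s :* q) := s :* (e :* q)) refl (η a) s q

module Neighbour {n : ℕ} {v : Fin (suc n) → Fin n → Bool} (S : NonobtuseDual v)
  (common-support : ∀ l i → l ≢ i → ∀ c →
     NonobtuseDual.g S l c ≢ 0ℚ → NonobtuseDual.g S i c ≢ 0ℚ → NonobtuseDual.gram S l i < 0ℚ)
  (i : Fin (suc n)) (notInFacet : ¬ InCubeFacet v i)
  {u : Fin (suc n) → Fin n → Bool} (T : NonobtuseDual u) (u≐v : ∀ j → j ≢ i → u j ≐ v j) where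

  private
    module T = NonobtuseProperties T
    x = embed v
    w = u i
  open NonobtuseProperties S

  -- The barycentric coordinate of the new vertex, evaluated at the old one: negative exactly when
  -- the facet separates the two.
  s : ℚ
  s = T.β i (x i)

  -- The function `T.β i` vanishes at all shared vertices, so its expansion over the old gradients
  -- keeps only `g i`.
  proportional : ∀ c → T.g i c ≡ s * g i c
  proportional c = begin
    T.g i c
      ≡⟨ sym (expandˡ (T.g i) c) ⟩
    Σ[ (λ l → dot (T.g i) (x l) * g l c) ]
      -- A multiple of the zero sum of gradients is added to turn linear parts into values of the
      -- affine function `T.β i`.
      ≡⟨ solve 2 (λ a k → a := a :+ k :* con 0ℚ) refl Σ[ (λ l → dot (T.g i) (x l) * g l c) ] (T.κ i) ⟩
    Σ[ (λ l → dot (T.g i) (x l) * g l c) ] + T.κ i * 0ℚ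
      ≡⟨ cong (λ z → Σ[ (λ l → dot (T.g i) (x l) * g l c) ] + z)
           (sym (trans (Σ-*ˡ (T.κ i) (λ l → g l c)) (cong (T.κ i *_) (Σg c)))) ⟩
    Σ[ (λ l → dot (T.g i) (x l) * g l c) ] + Σ[ (λ l → T.κ i * g l c) ]
      ≡⟨ sym (Σ-+ (λ l → dot (T.g i) (x l) * g l c) (λ l → T.κ i * g l c)) ⟩
    Σ[ (λ l → dot (T.g i) (x l) * g l c + T.κ i * g l c) ]
      ≡⟨ Σ-cong (λ l → sym (*-distribʳ-+ (g l c) (dot (T.g i) (x l)) (T.κ i))) ⟩
    Σ[ (λ l → T.β i (x l) * g l c) ]
      ≡⟨ Σ-single (λ l → T.β i (x l) * g l c) i (λ l ne →
           trans (cong (_* g l c) (β-facet l ne)) (*-zeroˡ (g l c))) ⟩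
    s * g i c ∎
    where
    open ≡-Reasoning
    β-facet : ∀ l → l ≢ i → T.β i (x l) ≡ 0ℚ
    β-facet l ne = trans (cong (_+ T.κ i) (dot-congʳ {h = T.g i} (λ c → cong toℚ (sym (u≐v l ne c)))))
      (trans (T.dual i l) (δ-≢ (λ e → ne (sym e))))

  w-sign : ∀ c → η (w c) * (s * g i c) ≤ 0ℚ
  w-sign c = subst (_≤ 0ℚ) (cong (η (w c) *_) (proportional c)) (T.gradient-sign i c)

  off-support : ∀ c → g i c ≡ 0ℚ → T.g i c ≡ 0ℚ
  off-support c e = trans (proportional c) (trans (cong (s *_) e) (*-zeroʳ s))

  Adjacent : Fin (suc n) → Set
  Adjacent l = l ≢ i × T.gram l i ≢ 0ℚ

  adjacent-off-support : ∀ {l} → Adjacent l → ∀ c → g i c ≡ 0ℚ → v l c ≡ w c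
  adjacent-off-support {l} (l≢i , G≢0) c e =
    trans (sym (u≐v l l≢i c)) (T.gradient-0 i c l (off-support c e) G≢0)

  -- The case to be refuted: the facets opposite `l` and `i` are orthogonal in the old simplex but
  -- not in the new one.
  module Orthogonal (c₁ : Fin n) (c₁∈ : g i c₁ ≢ 0ℚ) (s≢0 : s ≢ 0ℚ)
    (l : Fin (suc n)) (adjacent : Adjacent l) (orthogonal : gram l i ≡ 0ℚ) where

    l≢i : l ≢ i
    l≢i = proj₁ adjacent

    G : ℚ
    G = T.gram l i

    disjoint : ∀ c → g i c ≢ 0ℚ → g l c ≡ 0ℚ
    disjoint c i≢0 with g l c ℚ.≟ 0ℚ
    ... | yes e = e
    ... | no  e = ⊥-elim (<-irrefl orthogonal (common-support l i l≢i c e i≢0))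

    -- Both vertices agree with the new vertex off the support of `g i`, and `g l` vanishes on that
    -- support, so barycentric coordinate `l` could not tell them apart.
    adjacent-unique : ∀ l′ → Adjacent l′ → l ≡ l′
    adjacent-unique l′ adjacent′ with l ≟ l′
    ... | yes e = e
    ... | no ne = ⊥-elim (1≢0 (neg-injective {1ℚ} {0ℚ} (begin
      - 1ℚ                    ≡⟨ sym (cong₂ _-_ (δ-≢ ne) (δ-refl l)) ⟩
      δ l l′ - δ l l          ≡⟨ sym (dual-⊖ l l′ l) ⟩
      dot (g l) (x l′ ⊖ x l)  ≡⟨ Σ-zero term ⟩
      0ℚ                      ∎)))
      where
      open ≡-Reasoning
      term : ∀ c → g l c * (x l′ c - x l c) ≡ 0ℚ
      term c with g i c ℚ.≟ 0ℚ
      ... | no  p = trans (cong (_* (x l′ c - x l c)) (disjoint c p)) (*-zeroˡ (x l′ c - x l c))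
      ... | yes p = trans (cong (λ z → g l c * (toℚ z - x l c))
                      (trans (adjacent-off-support adjacent′ c p) (sym (adjacent-off-support adjacent c p))))
                      (trans (cong (g l c *_) (+-inverseʳ (x l c))) (*-zeroʳ (g l c)))

    signed-w : ∀ c → η (w c) * (s * g i c) ≡ G * toℚ (v l c xor w c)
    signed-w c = begin
      η (w c) * (s * g i c)
        ≡⟨ cong (η (w c) *_) (sym (proportional c)) ⟩
      η (w c) * T.g i c
        ≡⟨ sym (T.signed-gradient i c (w c)) ⟩
      Σ[ (λ j → T.gram j i * toℚ (u j c xor w c)) ]
        ≡⟨ Σ-single (λ j → T.gram j i * toℚ (u j c xor w c)) l other ⟩
      G * toℚ (u l c xor w c)
        ≡⟨ cong (λ z → G * toℚ (z xor w c)) (u≐v l l≢i c) ⟩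
      G * toℚ (v l c xor w c) ∎
      where
      open ≡-Reasoning
      other : ∀ j → j ≢ l → T.gram j i * toℚ (u j c xor w c) ≡ 0ℚ
      other j j≢l with j ≟ i
      ... | yes refl = trans (cong (λ z → T.gram j j * toℚ z) (xor-self (u j c))) (*-zeroʳ (T.gram j j))
      ... | no j≢i with T.gram j i ℚ.≟ 0ℚ
      ...   | yes e = trans (cong (_* toℚ (u j c xor w c)) e) (*-zeroˡ (toℚ (u j c xor w c)))
      ...   | no  e = ⊥-elim (j≢l (sym (adjacent-unique j (j≢i , e))))

    on-support : ∀ c → g i c ≢ 0ℚ → v l c ≡ not (w c)
    on-support c i≢0 = not-≡ (λ e → i≢0 (p*q≡0 s (g i c) (p*q≡0 (η (w c)) (s * g i c)
      (trans (signed-w c) (trans (cong (λ z → G * toℚ (z xor w c)) e)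
        (trans (cong (λ z → G * toℚ z) (xor-self (w c))) (*-zeroʳ G)))) (η≢0 (w c))) s≢0))

    -- For negative `s` the new vertex is complementary to both `v i` and `v l` on the support of
    -- `g i`. Then `v i` and `v l` coincide there, although barycentric coordinate `i` separates
    -- them.
    not-negative : ¬ s < 0ℚ
    not-negative s<0 = 1≢0 (begin
      1ℚ                       ≡⟨ sym (cong₂ _-_ (δ-refl i) (δ-≢ (λ e → l≢i (sym e)))) ⟩
      δ i i - δ i l            ≡⟨ sym (dual-⊖ i i l) ⟩
      dot (g i) (x i ⊖ x l)    ≡⟨ Σ-zero term ⟩
      0ℚ                       ∎)
      where
      open ≡-Reasoning
      not-not : ∀ b → not (not b) ≡ b
      not-not true  = refl
      not-not false = refl
      term : ∀ c → g i c * (x i c - x l c) ≡ 0ℚ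
      term c with g i c ℚ.≟ 0ℚ
      ... | yes e = trans (cong (_* (x i c - x l c)) e) (*-zeroˡ (x i c - x l c))
      ... | no ne = trans (cong (λ z → g i c * (x i c - toℚ z)) (trans (on-support c ne)
                      (trans (cong not (opposite-sign (v i c) (w c) s<0 ne (gradient-sign i c) (w-sign c))) (not-not (v i c)))))
                      (trans (cong (g i c *_) (+-inverseʳ (x i c))) (*-zeroʳ (g i c)))

    module Positive (0<s : 0ℚ < s) where

      w≡v : ∀ c → g i c ≢ 0ℚ → w c ≡ v i c
      w≡v c ne = same-sign (v i c) (w c) 0<s ne (gradient-sign i c) (w-sign c)

      l-opposite : ∀ c → g i c ≢ 0ℚ → v l c ≡ not (v i c)
      l-opposite c ne = trans (on-support c ne) (cong not (w≡v c ne))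

      signed-v : ∀ c → g i c ≢ 0ℚ → η (v i c) * (s * g i c) ≡ G
      signed-v c ne = begin
        η (v i c) * (s * g i c)            ≡⟨ cong (λ b → η b * (s * g i c)) (sym (w≡v c ne)) ⟩
        η (w c) * (s * g i c)              ≡⟨ signed-w c ⟩
        G * toℚ (v l c xor w c)            ≡⟨ cong (λ b → G * toℚ (b xor w c)) (on-support c ne) ⟩
        G * toℚ (not (w c) xor w c)        ≡⟨ cong (λ b → G * toℚ b) (not-xor (w c)) ⟩
        G * 1ℚ                             ≡⟨ *-identityʳ G ⟩
        G                                  ∎
        where open ≡-Reasoning

      -- By `signed-v` the entries of `g i` on its support share one absolute value. So `s` times
      -- each square is `G` times `g i c * (x l c - x i c)`, and the latter products sum to a
      -- difference of barycentric coordinates, - 1.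
      norm : s * gram i i ≡ - G
      norm = begin
        s * gram i i
          ≡⟨ sym (Σ-*ˡ s (λ c → g i c * g i c)) ⟩
        Σ[ (λ c → s * (g i c * g i c)) ]
          ≡⟨ Σ-cong term ⟩
        Σ[ (λ c → G * (g i c * (x l c - x i c))) ]
          ≡⟨ Σ-*ˡ G (λ c → g i c * (x l c - x i c)) ⟩
        G * dot (g i) (x l ⊖ x i)
          ≡⟨ cong (G *_) (trans (dual-⊖ i l i) (cong₂ _-_ (δ-≢ (λ e → l≢i (sym e))) (δ-refl i))) ⟩
        G * (0ℚ - 1ℚ)
          ≡⟨ solve 1 (λ a → a :* (con 0ℚ :- con 1ℚ) := :- a) refl G ⟩
        - G ∎
        where
        open ≡-Reasoning
        term : ∀ c → s * (g i c * g i c) ≡ G * (g i c * (x l c - x i c))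
        term c with g i c ℚ.≟ 0ℚ
        ... | yes e = trans (cong (λ z → s * (z * z)) e) (trans (*-zeroʳ s)
                        (sym (trans (cong (λ z → G * (z * (x l c - x i c))) e)
                          (solve 2 (λ a b → a :* (con 0ℚ :* b) := con 0ℚ) refl G (x l c - x i c)))))
        ... | no ne = begin
          s * (g i c * g i c)
            ≡⟨ sym (*-identityˡ (s * (g i c * g i c))) ⟩
          1ℚ * (s * (g i c * g i c))
            ≡⟨ cong (_* (s * (g i c * g i c))) (sym (η² (v i c))) ⟩
          η (v i c) * η (v i c) * (s * (g i c * g i c))
            ≡⟨ solve 3 (λ e s q → e :* e :* (s :* (q :* q)) := e :* (s :* q) :* (q :* e)) refl (η (v i c)) s (g i c) ⟩
          η (v i c) * (s * g i c) * (g i c * η (v i c))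
            ≡⟨ cong₂ (λ a b → a * (g i c * b)) (signed-v c ne)
                 (sym (trans (cong (λ b → toℚ b - x i c) (l-opposite c ne)) (toℚ-not (v i c)))) ⟩
          G * (g i c * (x l c - x i c)) ∎

      -- At c in the support, the weights of the vertices differing from v i at c already exhaust gram i i.
      all-opposite : ∀ c → g i c ≢ 0ℚ → ∀ k → k ≢ i → gram k i ≢ 0ℚ → v k c xor v i c ≡ true
      all-opposite c ne k k≢i G≢0 = toℚ-injective {b = true} (begin
        X k              ≡⟨ solve 1 (λ a → a := con 1ℚ :- (con 1ℚ :- a :- con 0ℚ)) refl (X k) ⟩
        1ℚ - (1ℚ - X k - 0ℚ)
          ≡⟨ cong (λ z → 1ℚ - (1ℚ - X k - z)) (sym (δ-≢ k≢i)) ⟩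
        1ℚ - (1ℚ - X k - δ k i)
          ≡⟨ cong (_-_ 1ℚ) (p*q≡0 (gram k i) (1ℚ - X k - δ k i) (f≡0 k) G≢0) ⟩
        1ℚ ∎)
        where
        open ≡-Reasoning
        X f : Fin (suc n) → ℚ
        X k = toℚ (v k c xor v i c)
        -- The `δ k i` cancels the diagonal entry. What remains are the nonpositive weights of the
        -- vertices agreeing with `v i` at `c`, and `ΣX` makes their sum zero.
        f k = gram k i * (1ℚ - X k - δ k i)
        ΣX : s * Σ[ (λ k → gram k i * X k) ] ≡ s * (- gram i i)
        ΣX = begin
          s * Σ[ (λ k → gram k i * X k) ]  ≡⟨ cong (s *_) (signed-gradient i c (v i c)) ⟩
          s * (η (v i c) * g i c)          ≡⟨ solve 3 (λ s e q → s :* (e :* q) := e :* (s :* q)) refl s (η (v i c)) (g i c) ⟩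
          η (v i c) * (s * g i c)          ≡⟨ signed-v c ne ⟩
          G                                ≡⟨ solve 1 (λ a → a := :- (:- a)) refl G ⟩
          - (- G)                          ≡⟨ cong -_ (sym norm) ⟩
          - (s * gram i i)                 ≡⟨ neg-distribʳ-* s (gram i i) ⟩
          s * (- gram i i)                 ∎
        Σf : s * Σ[ f ] ≡ 0ℚ
        Σf = begin
          s * Σ[ f ]
            ≡⟨ cong (s *_) (Σ-cong (λ k → solve 3 (λ a y d → a :* (con 1ℚ :- y :- d) := a :- a :* y :- a :* d)
                 refl (gram k i) (X k) (δ k i))) ⟩
          s * Σ[ (λ k → gram k i - gram k i * X k - gram k i * δ k i) ]
            ≡⟨ cong (s *_) (trans (Σ-- (λ k → gram k i - gram k i * X k) (λ k → gram k i * δ k i))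
                 (cong₂ _-_ (Σ-- (λ k → gram k i) (λ k → gram k i * X k)) (Σ-δʳ i (λ k → gram k i)))) ⟩
          s * (Σ[ (λ k → gram k i) ] - Σ[ (λ k → gram k i * X k) ] - gram i i)
            ≡⟨ cong (λ z → s * (z - Σ[ (λ k → gram k i * X k) ] - gram i i)) (Σ-dot (g i)) ⟩
          s * (0ℚ - Σ[ (λ k → gram k i * X k) ] - gram i i)
            ≡⟨ solve 3 (λ s y n → s :* (con 0ℚ :- y :- n) := :- (s :* y) :- s :* n) refl s Σ[ (λ k → gram k i * X k) ] (gram i i) ⟩
          - (s * Σ[ (λ k → gram k i * X k) ]) - s * gram i i
            ≡⟨ cong (λ z → - z - s * gram i i) ΣX ⟩
          - (s * (- gram i i)) - s * gram i i
            ≡⟨ solve 2 (λ s n → :- (s :* (:- n)) :- s :* n := con 0ℚ) refl s (gram i i) ⟩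
          0ℚ ∎
        1-toℚ-nonneg : ∀ b → 0ℚ ≤ 1ℚ - toℚ b - 0ℚ
        1-toℚ-nonneg true  = ≤-refl
        1-toℚ-nonneg false = 0≤1
        f≤0 : ∀ k → f k ≤ 0ℚ
        f≤0 k with k ≟ i
        ... | yes refl = ≤-reflexive (trans (cong₂ (λ a b → gram k k * (1ℚ - toℚ a - b)) (xor-self (v k c)) (δ-refl k))
                           (*-zeroʳ (gram k k)))
        ... | no k≢i   = subst (λ z → gram k i * (1ℚ - X k - z) ≤ 0ℚ) (sym (δ-≢ k≢i))
                           (*-nonpos-nonneg (gram≤0 k i k≢i) (1-toℚ-nonneg (v k c xor v i c)))
        f≡0 : ∀ k → f k ≡ 0ℚ
        f≡0 k = neg-injective (Σ-nonneg-0 (λ k → neg-antimono-≤ (f≤0 k))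
          (trans (Σ-neg f) (cong -_ (p*q≡0 s Σ[ f ] Σf s≢0))) k)

      -- A vertex other than `i` with nonzero gradient at `c₁` is not orthogonal to `i`, so at `d`
      -- its bit is opposite to `v i d`. As the gradients sum to zero, the sum in `Σgx c₁ d` becomes
      -- `- (g i c₁ * η (v i d))`, which is nonzero, whereas distinct `c₁` and `d` would make it
      -- zero.
      support-single : ∀ d → g i d ≢ 0ℚ → c₁ ≡ d
      support-single d d∈ with c₁ ≟ d
      ... | yes e = e
      ... | no ne = ⊥-elim (η≢0 (v i d) (p*q≡0 (g i c₁) (η (v i d)) (neg-injective (begin
        - (g i c₁ * η (v i d))
          ≡⟨ solve 3 (λ q e u → :- (q :* e) := con 0ℚ :* (e :+ u) :- q :* e) refl (g i c₁) (η (v i d)) (x i d) ⟩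
        0ℚ * (η (v i d) + x i d) - g i c₁ * η (v i d)
          ≡⟨ sym (cong₂ _-_ (trans (Σ-*ʳ (λ k → g k c₁) (η (v i d) + x i d)) (cong (_* (η (v i d) + x i d)) (Σg c₁)))
                            (Σ-δʳ i (λ k → g k c₁ * η (v i d)))) ⟩
        Σ[ (λ k → g k c₁ * (η (v i d) + x i d)) ] - Σ[ (λ k → g k c₁ * η (v i d) * δ k i) ]
          ≡⟨ sym (Σ-- (λ k → g k c₁ * (η (v i d) + x i d)) (λ k → g k c₁ * η (v i d) * δ k i)) ⟩
        Σ[ (λ k → g k c₁ * (η (v i d) + x i d) - g k c₁ * η (v i d) * δ k i) ]
          ≡⟨ Σ-cong (λ k → sym (term k)) ⟩
        Σ[ (λ k → g k c₁ * x k d) ]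
          ≡⟨ Σgx c₁ d ⟩
        δ c₁ d
          ≡⟨ δ-≢ ne ⟩
        0ℚ ∎)) c₁∈))
        where
        open ≡-Reasoning
        opposite⇒ : ∀ a b → a xor b ≡ true → toℚ a ≡ η b + toℚ b
        opposite⇒ true  false _ = refl
        opposite⇒ false true  _ = refl
        opposite⇒ true  true  ()
        opposite⇒ false false ()
        -- The number `η (v i d) + x i d` is the bit opposite to `v i d`; among the vertices of
        -- nonzero weight only `i` deviates from it.
        term : ∀ k → g k c₁ * x k d ≡ g k c₁ * (η (v i d) + x i d) - g k c₁ * η (v i d) * δ k i
        term k with k ≟ i
        ... | yes refl = trans
          (solve 3 (λ q e u → q :* u := q :* (e :+ u) :- q :* e :* con 1ℚ) refl (g k c₁) (η (v k d)) (x k d))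
          (cong (λ z → g k c₁ * (η (v k d) + x k d) - g k c₁ * η (v k d) * z) (sym (δ-refl k)))
        ... | no k≢i with g k c₁ ℚ.≟ 0ℚ
        ...   | yes e = trans (cong (_* x k d) e) (trans
          (solve 4 (λ y e u z → con 0ℚ :* y := con 0ℚ :* (e :+ u) :- con 0ℚ :* e :* z) refl (x k d) (η (v i d)) (x i d) (δ k i))
          (cong (λ q → q * (η (v i d) + x i d) - q * η (v i d) * δ k i) (sym e)))
        ...   | no  e = trans
          (cong (g k c₁ *_) (opposite⇒ (v k d) (v i d) (all-opposite d d∈ k k≢i
            (λ G≡0 → <-irrefl G≡0 (common-support k i k≢i c₁ e c₁∈)))))
          (trans (solve 3 (λ q e u → q :* (e :+ u) := q :* (e :+ u) :- q :* e :* con 0ℚ) refl (g k c₁) (η (v i d)) (x i d))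
            (cong (λ z → g k c₁ * (η (v i d) + x i d) - g k c₁ * η (v i d) * z) (sym (δ-≢ k≢i))))

      -- With `g i` supported at `c₁` alone, vertices sharing the value 0 of barycentric coordinate
      -- `i` share their bit at `c₁`.
      inCubeFacet : InCubeFacet v i
      inCubeFacet = c₁ , v l c₁ , same
        where
        same : ∀ j → j ≢ i → v j c₁ ≡ v l c₁
        same j j≢i = toℚ-injective (begin
          x j c₁                      ≡⟨ solve 2 (λ a b → a := (a :- b) :+ b) refl (x j c₁) (x l c₁) ⟩
          (x j c₁ - x l c₁) + x l c₁  ≡⟨ cong (_+ x l c₁) (p*q≡0 (g i c₁) (x j c₁ - x l c₁) product≡0 c₁∈) ⟩
          0ℚ + x l c₁                 ≡⟨ +-identityˡ (x l c₁) ⟩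
          x l c₁                      ∎)
          where
          open ≡-Reasoning
          off : ∀ d → d ≢ c₁ → g i d * (x j d - x l d) ≡ 0ℚ
          off d ne with g i d ℚ.≟ 0ℚ
          ... | yes e = trans (cong (_* (x j d - x l d)) e) (*-zeroˡ (x j d - x l d))
          ... | no  e = ⊥-elim (ne (sym (support-single d e)))
          product≡0 : g i c₁ * (x j c₁ - x l c₁) ≡ 0ℚ
          product≡0 = trans (sym (Σ-single (λ d → g i d * (x j d - x l d)) c₁ off))
            (trans (dual-⊖ i j l) (cong₂ _-_ (δ-≢ (λ e → j≢i (sym e))) (δ-≢ (λ e → l≢i (sym e)))))

    impossible : ⊥
    impossible with <-cmp s 0ℚ
    ... | tri< p _ _ = not-negative p
    ... | tri≈ _ p _ = s≢0 p
    ... | tri> _ _ p = notInFacet (Positive.inCubeFacet p)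

  -- The parameter `d` certifies positive dimension for `gradient-nonzero`.
  module _ (d : Fin n) where

    s≢0 : s ≢ 0ℚ
    s≢0 e = let (c , ne) = gradient-nonzero T.dualBasis d i in
      ne (trans (proportional c) (trans (cong (_* g i c) e) (*-zeroˡ (g i c))))

    -- A nonzero entry of the new gradient forces a nonzero term in its signed sum; the term of `i`
    -- itself is always zero.
    some-adjacent : ∃ Adjacent
    some-adjacent = at (gradient-nonzero T.dualBasis d i)
      where
      term : Fin n → Fin (suc n) → ℚ
      term c l = T.gram l i * toℚ (u l c xor u i c)
      touches : ∀ c l → term c l ≢ 0ℚ → Adjacent l
      touches c l l≢0 =
        (λ { refl → l≢0 (trans (cong (λ b → T.gram l l * toℚ b) (xor-self (u l c))) (*-zeroʳ (T.gram l l))) }) ,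
        (λ e → l≢0 (trans (cong (_* toℚ (u l c xor u i c)) e) (*-zeroˡ (toℚ (u l c xor u i c)))))
      Σ≢0 : ∀ c → T.g i c ≢ 0ℚ → Σ[ term c ] ≢ 0ℚ
      Σ≢0 c ne e = ne (p*q≡0 (η (u i c)) (T.g i c) (trans (sym (T.signed-gradient i c (u i c))) e) (η≢0 (u i c)))
      at : (∃ λ c → T.g i c ≢ 0ℚ) → ∃ Adjacent
      at (c , ne) = find (Σ-≢0 (term c) (Σ≢0 c ne))
        where
        find : (∃ λ l → term c l ≢ 0ℚ) → ∃ Adjacent
        find (l , l≢0) = l , touches c l l≢0

    -- An adjacent vertex equals the new vertex off the support. If it is also non-orthogonal to `i`
    -- in the old simplex, `gradient-0` equates it with `v i` there; otherwise `Orthogonal` applies.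
    agrees-off-support : ∀ c → g i c ≡ 0ℚ → w c ≡ v i c
    agrees-off-support c e = from some-adjacent (gradient-nonzero dualBasis d i)
      where
      from : ∃ Adjacent → (∃ λ c₁ → g i c₁ ≢ 0ℚ) → w c ≡ v i c
      from (l , adjacent) (c₁ , c₁∈) with gram l i ℚ.≟ 0ℚ
      ... | no  p = trans (sym (adjacent-off-support adjacent c e)) (gradient-0 i c l e p)
      ... | yes p = ⊥-elim (Orthogonal.impossible c₁ c₁∈ s≢0 l adjacent p)

    -- A positive `s` would give agreement on the support as well as off it, hence the old vertex.
    opposite-on-support : ¬ (w ≐ v i) → ∀ c → g i c ≢ 0ℚ → w c ≡ not (v i c)
    opposite-on-support w≢v c ne with <-cmp s 0ℚ
    ... | tri< p _ _ = opposite-sign (v i c) (w c) p ne (gradient-sign i c) (w-sign c)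
    ... | tri≈ _ p _ = ⊥-elim (s≢0 p)
    ... | tri> _ _ p = ⊥-elim (w≢v agree)
      where
      agree : w ≐ v i
      agree c with g i c ℚ.≟ 0ℚ
      ... | yes e = agrees-off-support c e
      ... | no ne = same-sign (v i c) (w c) p ne (gradient-sign i c) (w-sign c)

-- The only candidate for a new vertex; it depends on `S` and `i` alone, which is what yields
-- uniqueness.
crossing : ∀ {n} {v : Fin (suc n) → Fin n → Bool} → NonobtuseDual v → Fin (suc n) → Fin n → Bool
crossing {v = v} S i c with NonobtuseDual.g S i c ℚ.≟ 0ℚ
... | yes _ = v i c
... | no  _ = not (v i c)

neighbour-crosses : ∀ {n} {v : Fin (suc n) → Fin n → Bool} (S : NonobtuseDual v) →
  (∀ l i → l ≢ i → ∀ c →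
     NonobtuseDual.g S l c ≢ 0ℚ → NonobtuseDual.g S i c ≢ 0ℚ → NonobtuseDual.gram S l i < 0ℚ) →
  ∀ i → ¬ InCubeFacet v i → ∀ {u} → NonobtuseDual u → (∀ j → j ≢ i → u j ≐ v j) →
  ¬ (u i ≐ v i) → u i ≐ crossing S i
neighbour-crosses S common-support i notInFacet T u≐v ui≢vi c with NonobtuseDual.g S i c ℚ.≟ 0ℚ
-- The coordinate `c` is passed twice, first as the witness of positive dimension.
... | yes e = Neighbour.agrees-off-support S common-support i notInFacet T u≐v c c e
... | no ne = Neighbour.opposite-on-support S common-support i notInFacet T u≐v c ui≢vi c ne

theorem6p9 : (n : ℕ) (v : Fin (suc n) → Fin n → Bool) →
    Is01Simplex v → Nonobtuse (embed v) → ComponentsAcute v →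
    (i : Fin (suc n)) → ¬ InCubeFacet v i →
    (w w′ : Fin n → Bool) →
    ¬ (w ≐ v i) → Is01Simplex (replace v i w) → Nonobtuse (embed (replace v i w)) →
    ¬ (w′ ≐ v i) → Is01Simplex (replace v i w′) → Nonobtuse (embed (replace v i w′)) →
    w ≐ w′
theorem6p9 n v simplex nonobtuse (o , components) i notInFacet w w′
  w≢v simplexʷ nonobtuseʷ w′≢v simplexʷ′ nonobtuseʷ′ c =
  trans (position w w≢v simplexʷ nonobtuseʷ) (sym (position w′ w′≢v simplexʷ′ nonobtuseʷ′))
  where
  S = nonobtuseDual v simplex nonobtuse
  position : ∀ w → ¬ (w ≐ v i) → Is01Simplex (replace v i w) → Nonobtuse (embed (replace v i w)) →
    w c ≡ crossing S i c
  position w w≢v simplexʷ nonobtuseʷ = trans (sym (at-i c)) (neighbour-crosses S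
    (Components.common-support⇒gram<0 S o components) i notInFacet
    (nonobtuseDual (replace v i w) simplexʷ nonobtuseʷ)
    (λ j ne c → cong (λ f → f c) (replace-off v i w j ne)) (λ e → w≢v (λ c → trans (sym (at-i c)) (e c))) c)
    where
    at-i : replace v i w i ≐ w
    at-i c = cong (λ f → f c) (replace-at v i w)
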